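{- Let $b,N,K,\Delta,R,L_0,L$ be positive integers with $2\le\Delta\le R-K<b-K-2$ and $\log_2N<K\le L_0\le L<b-\log_2(b+10)$. All configurations below are configurations over a fixed set of $N$ levels as in the context (with $z<2^b$). Then: (1) If a configuration consists of exactly one significand, in level $\lambda$, then $G=L_0+1-b-\lambda$ satisfies $2^K\le A(G)<2^b$. (2) Let $C$ be a configuration and $C'$ the configuration obtained by adding one significand to level $\ell$; write $SS'_\ell$, $A'_\ell(\cdot)$, $A'(\cdot)$ for the quantities of $C'$ and $A(\cdot)$ for those of $C$. Let $G$ be an integer with $A(G)<2^b$. (a) If $A'_\ell(G)\ge 2^b$, then $G_\downarrow=R-\lfloor\log_2 SS'_\ell\rfloor-\ell$ satisfies $2^K\le A'(G_\downarrow)<2^b$. (b) If $A'_\ell(G)<2^b$ but $A'(G)\ge 2^b$, then $G_\downarrow=G-\Delta$ satisfies $2^K\le A'(G_\downarrow)<2^b$. (3) If $C'$ is obtained from $C$ by removing significands, then $A'(G)\le A(G)$ for every integer $G$; in particular $A(G)<2^b$ implies $A'(G)<2^b$. (4) For any nonempty configuration with largest nonempty level $\lambda$, let $H_r=\lfloor SS_{\lambda-r}/2^b\rfloor$ for $r=0,\dots,b$, $E=\sum_{r=0}^b\lfloor H_r2^{ -r+1}\rfloor$, $t=\lfloor\log_2\max\{E,1\}\rfloor$, and $G_\uparrow=L+1-b-t-\lambda$. Then $2^L\le A(G_\uparrow)<2^b$.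
   Context: Fix an integer $b\ge 2$. There is a set $\mathcal L$ of $N$ levels, which are consecutive integers. Each level $\ell$ holds a finite (possibly empty) multiset of normalized significands, each an integer in $[2^{b-1},2^b)$. Let $z$ be the total number of stored significands over all levels; assume $z<2^b$. For each level, $SS_\ell$ is the sum of its significands (so $SS_\ell=0$ iff the level is empty); set $SS_\ell=0$ for integers $\ell\notin\mathcal L$. The level weight is $W_\ell=SS_\ell2^\ell$. For an integer global shift $G$, $A_\ell(G)=\lfloor W_\ell2^G\rfloor+1$ if $SS_\ell>0$ and $A_\ell(G)=0$ if $SS_\ell=0$; $A(G)=\sum_\ell A_\ell(G)$ and $M(G)=\sum_\ell W_\ell2^G$. The configuration is nonempty if $z\ge1$. (In the paper's terminology a shift $G$ is safe if $A(G)<2^b$, good if $A(G)\ge2^K$, strongly good if $A(G)\ge 2^L$.) -}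

module Defs where

open import Data.Bool.Base using (if_then_else_)
open import Data.Integer.Base using (ℤ; +_; -[1+_]; 0ℤ; 1ℤ; ∣_∣; _⊔_)
open import Data.List.Base using (List; []; _∷_; _++_; foldr; length; map; upTo)
open import Data.List.Membership.Propositional using (_∉_)
open import Data.List.Relation.Binary.Permutation.Propositional using (_↭_)
open import Data.List.Relation.Unary.All using (All)
open import Data.Nat.Base using (ℕ; suc; _∸_; _^_; _≡ᵇ_)
open import Data.Nat.ListAction using (sum)
open import Data.Nat.Logarithm using (⌊log₂_⌋)
open import Data.Nat.Properties using (m^n≢0)
open import Data.Product.Base using (_×_; ∃-syntax)
open import Data.Rational.Base using (ℚ; floor)
open import Relation.Binary.PropositionalEquality.Core using (_≡_; _≢_)
import Data.Integer.Base as ℤ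
import Data.Nat.Base as ℕ
import Data.Rational.Base as ℚ

toℚ : ℕ → ℚ
toℚ n = + n ℚ./ 1

pow2 : ℤ → ℚ
pow2 (+ n)    = toℚ (2 ^ n)
pow2 -[1+ n ] = ℚ._/_ 1ℤ (2 ^ suc n) {{m^n≢0 2 (suc n)}}

-- The real inequality log₂ n < m, for n ≥ 1 and an integer m (possibly
-- negative), is n < 2^m.
log₂_<_ : ℕ → ℤ → Set
log₂ n < m = toℚ n ℚ.< pow2 m

sumℤ : List ℤ → ℤ
sumℤ = foldr ℤ._+_ 0ℤ

IsSignificand : ℕ → ℕ → Set
IsSignificand b s = 2 ^ (b ∸ 1) ℕ.≤ s × s ℕ.< 2 ^ b

levels : ℤ → ℕ → List ℤ
levels ℓ₀ N = map (λ i → ℓ₀ ℤ.+ + i) (upTo N)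

-- Multisets are represented by lists and compared up to permutation (_↭_).
-- Contents are indexed by all integers and are empty off the set of levels,
-- so that SS ℓ = 0 there.
record Configuration (b : ℕ) (ℓ₀ : ℤ) (N : ℕ) : Set where
  field
    contents     : ℤ → List ℕ
    outside      : ∀ {ℓ} → ℓ ∉ levels ℓ₀ N → contents ℓ ≡ []
    significands : ∀ ℓ → All (IsSignificand b) (contents ℓ)

  z : ℕ
  z = sum (map (λ ℓ → length (contents ℓ)) (levels ℓ₀ N))

  field
    z<2^b : z ℕ.< 2 ^ b

  SS : ℤ → ℕ
  SS ℓ = sum (contents ℓ)

  W : ℤ → ℚ
  W ℓ = toℚ (SS ℓ) ℚ.* pow2 ℓ

  Aₗ : ℤ → ℤ → ℤ
  Aₗ ℓ G = if SS ℓ ≡ᵇ 0 then 0ℤ else floor (W ℓ ℚ.* pow2 G) ℤ.+ 1ℤ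

  A : ℤ → ℤ
  A G = sumℤ (map (λ ℓ → Aₗ ℓ G) (levels ℓ₀ N))

  H : ℤ → ℕ → ℕ
  H top r = ℕ._/_ (SS (top ℤ.- + r)) (2 ^ b) {{m^n≢0 2 b}}

  E : ℤ → ℤ
  E top = sumℤ (map (λ r → floor (toℚ (H top r) ℚ.* pow2 (ℤ.- + r ℤ.+ 1ℤ)))
                    (upTo (suc b)))

  t : ℤ → ℕ
  t top = ⌊log₂ ∣ E top ⊔ 1ℤ ∣ ⌋

open Configuration public

module _ {b : ℕ} {ℓ₀ : ℤ} {N : ℕ} where

  IsSingleton : Configuration b ℓ₀ N → ℤ → Set
  IsSingleton C ℓ =
    (∃[ s ] contents C ℓ ≡ s ∷ []) × (∀ j → j ≢ ℓ → contents C j ≡ [])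

  AddedAt : ℤ → Configuration b ℓ₀ N → Configuration b ℓ₀ N → Set
  AddedAt ℓ C C′ =
    (∃[ s ] contents C′ ℓ ↭ s ∷ contents C ℓ)
    × (∀ j → j ≢ ℓ → contents C′ j ↭ contents C j)

  RemovedFrom : Configuration b ℓ₀ N → Configuration b ℓ₀ N → Set
  RemovedFrom C C′ = ∀ ℓ → ∃[ removed ] contents C ℓ ↭ removed ++ contents C′ ℓ

  Nonempty : Configuration b ℓ₀ N → Set
  Nonempty C = 1 ℕ.≤ z C

  LargestNonempty : Configuration b ℓ₀ N → ℤ → Set
  LargestNonempty C ℓ =
    contents C ℓ ≢ [] × (∀ j → ℓ ℤ.< j → contents C j ≡ [])

{-# OPTIONS --safe #-}
module Submission where

open import Defs
open import Data.Integer.Base using (ℤ; +_; 1ℤ; _+_; _-_; _≤_; _<_; _≥_)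
open import Data.Nat.Base using (ℕ; _^_)
open import Data.Nat.Logarithm using (⌊log₂_⌋)
open import Data.Product.Base using (_×_)
import Data.Nat.Base as ℕ

open import Data.Bool.Base using (if_then_else_)
open import Data.Empty using (⊥-elim)
open import Data.Integer.Base using (-[1+_]; 0ℤ)
open import Data.List.Base using (List; []; _∷_; _++_; map; length; upTo; applyUpTo)
open import Data.List.Membership.Propositional using (_∈_)
open import Data.List.Membership.Propositional.Properties using (∈-∃++; ∈-++⁻; ∈-++⁺ˡ; ∈-++⁺ʳ; ∈-map⁺; ∈-upTo⁺)
open import Data.List.Relation.Unary.All as All using (All; []; _∷_)
open import Data.List.Relation.Unary.Any using (here; there)
open import Data.List.Relation.Unary.Unique.Propositional using (Unique; []; _∷_)
open import Data.List.Relation.Unary.Unique.Propositional.Properties using (map⁺; upTo⁺)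
open import Data.Nat.Base using (zero; suc; _∸_; NonZero; ⌊_/2⌋; z≤n; s≤s)
open import Data.Nat.Induction using (<-rec)
open import Data.Nat.ListAction using (sum)
open import Data.Nat.ListAction.Properties using (sum-↭; sum-++)
open import Data.Nat.Logarithm using (⌊log₂⌋-mono-≤; ⌊log₂[2^n]⌋≡n; ⌊log₂⌊n/2⌋⌋≡⌊log₂n⌋∸1)
open import Data.Product.Base using (_,_; proj₁; proj₂)
open import Data.Rational.Base using (mkℚ; floor; toℚᵘ)
open import Data.Rational.Unnormalised.Base using (*≡*; *<*) renaming (_≃_ to _≃ᵘ_; _/_ to _/ᵘ_)
open import Data.Sum.Base using (_⊎_; inj₁; inj₂)
open import Relation.Binary.PropositionalEquality
open import Relation.Nullary using (yes; no)
import Data.Integer.Base as ℤ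
import Data.Integer.Properties as ℤ
import Data.Integer.Tactic.RingSolver as ℤSolver
import Data.List.Membership.DecPropositional as DecMembership
import Data.List.Properties as List
import Data.List.Relation.Binary.Permutation.Propositional.Properties as Perm
import Data.Nat.DivMod as ℕ
import Data.Nat.Properties as ℕ
import Data.Nat.Tactic.RingSolver as ℕSolver
import Data.Rational.Base as ℚ
import Data.Rational.Properties as ℚ
import Data.Rational.Unnormalised.Base as ℚᵘ
import Data.Rational.Unnormalised.Properties as ℚᵘ

open import Algebra.Properties.AbelianGroup ℤ.+-0-abelianGroup using (∙-cancelˡ)
open import Algebra.Properties.CommutativeSemigroup ℕ.+-commutativeSemigroup using (interchange; x∙yz≈y∙xz)
open import Algebra.Properties.CommutativeSemigroup ℕ.*-commutativeSemigroup using () renaming (xy∙z≈xz∙y to swapʳ)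

-- All quantities become natural numbers: approx s e is ⌊s 2^e⌋ + 1, or 0 when
-- s = 0. Replacing e by e - d with d ≥ 2 divides it by 2^d up to the final +1,
-- so lowering G at least quarters A(G) up to one unit per level, and
-- N < 2^K bounds these units; since A ≥ M and A ≤ M + N, only M matters.
-- For the upward shift, SS_{λ-r} 2^{-r} = 2^{b-1} ⌊H_r 2^{1-r}⌋ up to an error
-- below 2^{b-1} (twice that for r = 0), and the levels below λ - b together
-- contribute at most z 2^b 2^{-b-1} < 2^{b-1}. Hence 2^t M(G↑) lies between
-- 2^L E and 2^L (E + b + 3), where 2^t ≤ max(E, 1) < 2^{t+1}; if E = 0, the
-- lower bound 2^L already comes from level λ, as SS_λ ≥ 2^{b-1}.

-- After an addition, four times the lowered total must stay below 4 * 2^b, and three blocks of at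
-- most 2^b pay for it: A(G), the units 4N, and level ℓ. In case (b) the last block is A'_ℓ(G)
-- itself. In case (a) A'_ℓ(G) can be arbitrarily large, so no fixed decrement would do; G↓ instead
-- normalizes level ℓ alone, to between 2^R and 2^(R+1). The margin R + 3 ≤ b then serves twice: it
-- bounds four times that level by 2^b, and it forces G - G↓ ≥ 2, so that every other level is still
-- quartered. For the upward shift, E is summed over λ - b, ..., λ and A over the stored levels, and
-- neither range need contain the other. Both are therefore treated as duplicate-free lists of
-- integers, and sums over them are compared by charging each element of one list to its own
-- occurrence in the other.

-- Rational powers of two as quotients of naturals

2^≢0 : ∀ n → NonZero (2 ^ n)
2^≢0 n = ℕ.m^n≢0 2 n

toℚᵘ-/ : ∀ i d .{{_ : NonZero d}} → toℚᵘ (i ℚ./ d) ≃ᵘ i /ᵘ d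
toℚᵘ-/ i (suc d) = ℚ.toℚᵘ-fromℚᵘ (ℚᵘ.mkℚᵘ i d)

/ᵘ-* : ∀ m n c d .{{_ : NonZero c}} .{{_ : NonZero d}} .{{_ : NonZero (c ℕ.* d)}} →
       (+ m /ᵘ c) ℚᵘ.* (+ n /ᵘ d) ≃ᵘ + (m ℕ.* n) /ᵘ (c ℕ.* d)
/ᵘ-* m n (suc c) (suc d) rewrite ℤ.pos-* m n = ℚᵘ.≃-refl

/ᵘ-cong : ∀ m n c d .{{_ : NonZero c}} .{{_ : NonZero d}} → m ℕ.* d ≡ n ℕ.* c → + m /ᵘ c ≃ᵘ + n /ᵘ d
/ᵘ-cong m n (suc c) (suc d) eq = *≡* (trans (sym (ℤ.pos-* m (suc d))) (trans (cong +_ eq) (ℤ.pos-* n (suc c))))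

toℚᵘ-*-/ : ∀ {p q} m n c d .{{_ : NonZero c}} .{{_ : NonZero d}} .{{_ : NonZero (c ℕ.* d)}} →
           toℚᵘ p ≃ᵘ + m /ᵘ c → toℚᵘ q ≃ᵘ + n /ᵘ d → toℚᵘ (p ℚ.* q) ≃ᵘ + (m ℕ.* n) /ᵘ (c ℕ.* d)
toℚᵘ-*-/ {p} {q} m n c d p≃ q≃ =
  ℚᵘ.≃-trans (ℚ.toℚᵘ-homo-* p q) (ℚᵘ.≃-trans (ℚᵘ.*-cong p≃ q≃) (/ᵘ-* m n c d))

/ᵘ-cancel-< : ∀ m n c d .{{_ : NonZero c}} .{{_ : NonZero d}} → (+ m /ᵘ c) ℚᵘ.< (+ n /ᵘ d) → m ℕ.* d ℕ.< n ℕ.* c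
/ᵘ-cancel-< m n (suc c) (suc d) (*<* lt) =
  ℤ.drop‿+<+ (subst₂ _<_ (sym (ℤ.pos-* m (suc d))) (sym (ℤ.pos-* n (suc c))) lt)

-- `floor` divides by the denominator of the reduced form of `q`; cross-multiplication shows that
-- the quotient is the same for every representing fraction, and a nonnegative numerator rules out
-- the negative case.
floor-/ : ∀ q n d .{{_ : NonZero d}} → toℚᵘ q ≃ᵘ + n /ᵘ d → floor q ≡ + (n ℕ./ d)
floor-/ (mkℚ -[1+ m ] e _) n (suc d) (*≡* eq) with () ← trans eq (sym (ℤ.pos-* n (suc e)))
floor-/ (mkℚ (+ m) e _) n (suc d) (*≡* eq) = trans (ℤ.*-identityˡ _) (cong +_ (begin
  m ℕ./ suc e                                ≡⟨ ℕ.m*n/o*n≡m/o m (suc d) (suc e) ⟨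
  (m ℕ.* suc d) ℕ./ (suc e ℕ.* suc d)        ≡⟨ ℕ./-congˡ md≡ne ⟩
  (n ℕ.* suc e) ℕ./ (suc e ℕ.* suc d)        ≡⟨ ℕ./-congʳ {m = n ℕ.* suc e} (ℕ.*-comm (suc e) (suc d)) ⟩
  (n ℕ.* suc e) ℕ./ (suc d ℕ.* suc e)        ≡⟨ ℕ.m*n/o*n≡m/o n (suc e) (suc d) ⟩
  n ℕ./ suc d ∎))
  where
  open ≡-Reasoning
  md≡ne : m ℕ.* suc d ≡ n ℕ.* suc e
  md≡ne = ℤ.+-injective (trans (ℤ.pos-* m (suc d)) (trans eq (sym (ℤ.pos-* n (suc e)))))

-- The exponents of numerator and denominator in 2^e, which spare later arguments a case split on
-- the sign of e.
pos neg : ℤ → ℕ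
pos (+ n)    = n
pos -[1+ n ] = 0
neg (+ n)    = 0
neg -[1+ n ] = suc n

pos-neg : ∀ e → e ≡ + pos e - + neg e
pos-neg (+ n)    = sym (ℤ.+-identityʳ (+ n))
pos-neg -[1+ n ] = refl

toℚᵘ-pow2 : ∀ e → toℚᵘ (pow2 e) ≃ᵘ ℚᵘ._/_ (+ (2 ^ pos e)) (2 ^ neg e) {{2^≢0 (neg e)}}
toℚᵘ-pow2 (+ n)    = toℚᵘ-/ (+ (2 ^ n)) 1
toℚᵘ-pow2 -[1+ n ] = toℚᵘ-/ 1ℤ (2 ^ suc n) {{2^≢0 (suc n)}}

2^-difference : ∀ {m n p q} → + m - + n ≡ + p - + q → 2 ^ m ℕ.* 2 ^ q ≡ 2 ^ p ℕ.* 2 ^ n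
2^-difference {m} {n} {p} {q} eq =
  trans (sym (ℕ.^-distribˡ-+-* 2 m q)) (trans (cong (2 ^_) m+q≡p+n) (ℕ.^-distribˡ-+-* 2 p n))
  where
  open ≡-Reasoning
  x≡[x-y]+y : ∀ x y z → x + z ≡ (x - y) + (y + z)
  x≡[x-y]+y = ℤSolver.solve-∀
  [x-y]+[z+y]≡x+z : ∀ x y z → (x - y) + (z + y) ≡ x + z
  [x-y]+[z+y]≡x+z = ℤSolver.solve-∀
  m+q≡p+n : m ℕ.+ q ≡ p ℕ.+ n
  m+q≡p+n = ℤ.+-injective (begin
    + m + + q                ≡⟨ x≡[x-y]+y (+ m) (+ n) (+ q) ⟩
    (+ m - + n) + (+ n + + q)  ≡⟨ cong (_+ (+ n + + q)) eq ⟩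
    (+ p - + q) + (+ n + + q)  ≡⟨ [x-y]+[z+y]≡x+z (+ p) (+ q) (+ n) ⟩
    + p + + n ∎)

pow2-+ : ∀ i j → pow2 i ℚ.* pow2 j ≡ pow2 (i + j)
pow2-+ i j = ℚ.toℚᵘ-injective (ℚᵘ.≃-trans
  (toℚᵘ-*-/ (2 ^ pos i) (2 ^ pos j) (2 ^ neg i) (2 ^ neg j) (toℚᵘ-pow2 i) (toℚᵘ-pow2 j))
  (ℚᵘ.≃-trans (/ᵘ-cong (2 ^ pos i ℕ.* 2 ^ pos j) (2 ^ pos (i + j)) (2 ^ neg i ℕ.* 2 ^ neg j) (2 ^ neg (i + j)) eq)
  (ℚᵘ.≃-sym (toℚᵘ-pow2 (i + j)))))
  where
  instance
    nzᵢ = 2^≢0 (neg i)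
    nzⱼ = 2^≢0 (neg j)
    nz₊ = 2^≢0 (neg (i + j))
    nz* = ℕ.m*n≢0 (2 ^ neg i) (2 ^ neg j)
  regroup : ∀ x y z w → (x - y) + (z - w) ≡ (x + z) - (y + w)
  regroup = ℤSolver.solve-∀
  eq : 2 ^ pos i ℕ.* 2 ^ pos j ℕ.* 2 ^ neg (i + j) ≡ 2 ^ pos (i + j) ℕ.* (2 ^ neg i ℕ.* 2 ^ neg j)
  eq rewrite sym (ℕ.^-distribˡ-+-* 2 (pos i) (pos j)) | sym (ℕ.^-distribˡ-+-* 2 (neg i) (neg j)) =
    2^-difference {pos i ℕ.+ pos j} {neg i ℕ.+ neg j} {pos (i + j)} {neg (i + j)}
      (trans (sym (regroup (+ pos i) (+ neg i) (+ pos j) (+ neg j)))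
             (trans (sym (cong₂ _+_ (pos-neg i) (pos-neg j))) (pos-neg (i + j))))

scale : ℕ → ℤ → ℕ
scale s e = ℕ._/_ (s ℕ.* 2 ^ pos e) (2 ^ neg e) {{2^≢0 (neg e)}}

floor-scale : ∀ s e → floor (toℚ s ℚ.* pow2 e) ≡ + scale s e
floor-scale s e = floor-/ (toℚ s ℚ.* pow2 e) (s ℕ.* 2 ^ pos e) (2 ^ neg e) (ℚᵘ.≃-trans
  (toℚᵘ-*-/ s (2 ^ pos e) 1 (2 ^ neg e) (toℚᵘ-/ (+ s) 1) (toℚᵘ-pow2 e))
  (/ᵘ-cong (s ℕ.* 2 ^ pos e) (s ℕ.* 2 ^ pos e) (1 ℕ.* 2 ^ neg e) (2 ^ neg e)
    (cong (s ℕ.* 2 ^ pos e ℕ.*_) (sym (ℕ.*-identityˡ (2 ^ neg e))))))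
  where instance
    nz = 2^≢0 (neg e)
    nz* = ℕ.m*n≢0 1 (2 ^ neg e)

-- The two bounds characterize `scale s e` as the floor of s 2^p / 2^q for every way of writing e as
-- p - q. This freedom lets each use choose p and q so that the relevant factors, such as 2^b or
-- 2^r, appear explicitly.
module _ (s : ℕ) {e : ℤ} {p q : ℕ} (e≡p-q : e ≡ + p - + q) where
  private
    m = scale s e
    P = 2 ^ pos e
    Q = 2 ^ neg e
    instance
      nzQ : NonZero Q
      nzQ = 2^≢0 (neg e)
      nzq : NonZero (2 ^ q)
      nzq = 2^≢0 q
    PQ : P ℕ.* 2 ^ q ≡ 2 ^ p ℕ.* Q
    PQ = 2^-difference {pos e} {neg e} {p} {q} (trans (sym (pos-neg e)) e≡p-q)
    sP2^q≡s2^pQ : s ℕ.* P ℕ.* 2 ^ q ≡ s ℕ.* 2 ^ p ℕ.* Q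
    sP2^q≡s2^pQ = trans (ℕ.*-assoc s P _) (trans (cong (s ℕ.*_) PQ) (sym (ℕ.*-assoc s _ Q)))
    open ℕ.≤-Reasoning

  scale-lower : scale s e ℕ.* 2 ^ q ℕ.≤ s ℕ.* 2 ^ p
  scale-lower = ℕ.*-cancelʳ-≤ _ _ Q (begin
    m ℕ.* 2 ^ q ℕ.* Q    ≡⟨ swapʳ m (2 ^ q) Q ⟩
    m ℕ.* Q ℕ.* 2 ^ q    ≤⟨ ℕ.*-monoˡ-≤ (2 ^ q) (ℕ.m/n*n≤m (s ℕ.* P) Q) ⟩
    s ℕ.* P ℕ.* 2 ^ q    ≡⟨ sP2^q≡s2^pQ ⟩
    s ℕ.* 2 ^ p ℕ.* Q    ∎)

  scale-upper : s ℕ.* 2 ^ p ℕ.< suc (scale s e) ℕ.* 2 ^ q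
  scale-upper = ℕ.*-cancelʳ-< Q _ _ (begin-strict
    s ℕ.* 2 ^ p ℕ.* Q    ≡⟨ sP2^q≡s2^pQ ⟨
    s ℕ.* P ℕ.* 2 ^ q    <⟨ ℕ.*-monoˡ-< (2 ^ q) sP<sucmQ ⟩
    suc m ℕ.* Q ℕ.* 2 ^ q ≡⟨ swapʳ (suc m) Q (2 ^ q) ⟩
    suc m ℕ.* 2 ^ q ℕ.* Q ∎)
    where
    sP<sucmQ : s ℕ.* P ℕ.< suc m ℕ.* Q
    sP<sucmQ = begin-strict
      s ℕ.* P                          ≡⟨ ℕ.m≡m%n+[m/n]*n (s ℕ.* P) Q ⟩
      (s ℕ.* P) ℕ.% Q ℕ.+ m ℕ.* Q      <⟨ ℕ.+-monoˡ-< (m ℕ.* Q) (ℕ.m%n<n (s ℕ.* P) Q) ⟩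
      suc m ℕ.* Q                      ∎

log₂<⇒ : ∀ {n e p q} → e ≡ + p - + q → log₂ n < e → n ℕ.* 2 ^ q ℕ.< 2 ^ p
log₂<⇒ {n} {e} {p} {q} e≡p-q lt = ℕ.*-cancelʳ-< (2 ^ neg e) _ _ (begin-strict
  n ℕ.* 2 ^ q ℕ.* 2 ^ neg e   ≡⟨ swapʳ n (2 ^ q) (2 ^ neg e) ⟩
  n ℕ.* 2 ^ neg e ℕ.* 2 ^ q   <⟨ ℕ.*-monoˡ-< (2 ^ q) n2^neg<2^pos ⟩
  2 ^ pos e ℕ.* 2 ^ q         ≡⟨ 2^-difference {pos e} {neg e} {p} {q} (trans (sym (pos-neg e)) e≡p-q) ⟩
  2 ^ p ℕ.* 2 ^ neg e         ∎)
  where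
  open ℕ.≤-Reasoning
  instance
    nzₑ = 2^≢0 (neg e)
    nzq = 2^≢0 q
  n2^neg<2^pos : n ℕ.* 2 ^ neg e ℕ.< 2 ^ pos e
  n2^neg<2^pos = subst (n ℕ.* 2 ^ neg e ℕ.<_) (ℕ.*-identityʳ (2 ^ pos e))
    (/ᵘ-cancel-< n (2 ^ pos e) 1 (2 ^ neg e)
      (ℚᵘ.<-respˡ-≃ (toℚᵘ-/ (+ n) 1) (ℚᵘ.<-respʳ-≃ (toℚᵘ-pow2 e) (ℚ.toℚᵘ-mono-< lt))))

-- Binary logarithms

2^-cancel-< : ∀ {m n} → 2 ^ m ℕ.< 2 ^ n → m ℕ.< n
2^-cancel-< {m} {n} lt = ℕ.≰⇒> λ n≤m → ℕ.<⇒≱ lt (ℕ.^-monoʳ-≤ 2 n≤m)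

-- Otherwise monotonicity of the logarithm would put the logarithm of 2^(k+1) at or below k.
n<2^[1+⌊log₂n⌋] : ∀ n → n ℕ.< 2 ^ suc ⌊log₂ n ⌋
n<2^[1+⌊log₂n⌋] n = ℕ.≰⇒> λ 2^≤n →
  ℕ.<⇒≱ (ℕ.n<1+n ⌊log₂ n ⌋)
    (subst (ℕ._≤ ⌊log₂ n ⌋) (⌊log₂[2^n]⌋≡n (suc ⌊log₂ n ⌋)) (⌊log₂⌋-mono-≤ 2^≤n))

2*⌊n/2⌋≤n : ∀ n → 2 ℕ.* ⌊ n /2⌋ ℕ.≤ n
2*⌊n/2⌋≤n n = begin
  ⌊ n /2⌋ ℕ.+ (⌊ n /2⌋ ℕ.+ 0)   ≡⟨ cong (⌊ n /2⌋ ℕ.+_) (ℕ.+-identityʳ _) ⟩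
  ⌊ n /2⌋ ℕ.+ ⌊ n /2⌋           ≤⟨ ℕ.+-monoʳ-≤ ⌊ n /2⌋ (ℕ.⌊n/2⌋≤⌈n/2⌉ n) ⟩
  ⌊ n /2⌋ ℕ.+ ℕ.⌈ n /2⌉         ≡⟨ ℕ.⌊n/2⌋+⌈n/2⌉≡n n ⟩
  n ∎
  where open ℕ.≤-Reasoning

-- Strong induction by halving: the logarithm drops by one, and doubling the rounded half does not
-- exceed `n`.
2^⌊log₂n⌋≤n : ∀ n → 1 ℕ.≤ n → 2 ^ ⌊log₂ n ⌋ ℕ.≤ n
2^⌊log₂n⌋≤n = <-rec _ step
  where
  open ℕ.≤-Reasoning
  step : ∀ n → (∀ {m} → m ℕ.< n → 1 ℕ.≤ m → 2 ^ ⌊log₂ m ⌋ ℕ.≤ m) → 1 ℕ.≤ n → 2 ^ ⌊log₂ n ⌋ ℕ.≤ n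
  step 1 _ _ = ℕ.≤-refl
  step n@(suc (suc n-2)) rec _ = begin
    2 ^ ⌊log₂ n ⌋                ≤⟨ ℕ.^-monoʳ-≤ 2 (ℕ.m≤n+m∸n ⌊log₂ n ⌋ 1) ⟩
    2 ^ suc (⌊log₂ n ⌋ ∸ 1)      ≡⟨ cong (λ l → 2 ^ suc l) (⌊log₂⌊n/2⌋⌋≡⌊log₂n⌋∸1 n) ⟨
    2 ℕ.* 2 ^ ⌊log₂ ⌊ n /2⌋ ⌋    ≤⟨ ℕ.*-monoʳ-≤ 2 (rec (ℕ.⌊n/2⌋<n (suc n-2)) (s≤s z≤n)) ⟩
    2 ℕ.* ⌊ n /2⌋                ≤⟨ 2*⌊n/2⌋≤n n ⟩
    n ∎

-- Sums over lists

∑ : ∀ {A : Set} → List A → (A → ℕ) → ℕ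
∑ xs f = sum (map f xs)

module _ {A : Set} where

  ∑-cong : ∀ (xs : List A) {f g} → (∀ x → f x ≡ g x) → ∑ xs f ≡ ∑ xs g
  ∑-cong xs f≗g = cong sum (List.map-cong f≗g xs)

  ∑-+ : ∀ (xs : List A) f g → ∑ xs (λ x → f x ℕ.+ g x) ≡ ∑ xs f ℕ.+ ∑ xs g
  ∑-+ []       f g = refl
  ∑-+ (x ∷ xs) f g rewrite ∑-+ xs f g = interchange (f x) (g x) (∑ xs f) (∑ xs g)

  ∑-* : ∀ (xs : List A) c f → ∑ xs (λ x → c ℕ.* f x) ≡ c ℕ.* ∑ xs f
  ∑-* []       c f = sym (ℕ.*-zeroʳ c)
  ∑-* (x ∷ xs) c f rewrite ∑-* xs c f = sym (ℕ.*-distribˡ-+ c (f x) (∑ xs f))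

  ∑-const : ∀ (xs : List A) c → ∑ xs (λ _ → c) ≡ length xs ℕ.* c
  ∑-const []       c = refl
  ∑-const (x ∷ xs) c = cong (c ℕ.+_) (∑-const xs c)

  ∑-mono : ∀ (xs : List A) {f g} → (∀ x → f x ℕ.≤ g x) → ∑ xs f ℕ.≤ ∑ xs g
  ∑-mono []       f≤g = z≤n
  ∑-mono (x ∷ xs) f≤g = ℕ.+-mono-≤ (f≤g x) (∑-mono xs f≤g)

  sumℤ-+ : ∀ (xs : List A) f {g} → (∀ x → g x ≡ + f x) → sumℤ (map g xs) ≡ + ∑ xs f
  sumℤ-+ []       f g≗+f = refl
  sumℤ-+ (x ∷ xs) f g≗+f = cong₂ _+_ (g≗+f x) (sumℤ-+ xs f g≗+f)

  -- A charging argument: `g` pays for elements found in `ys`, while `k` is available to all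
  -- elements. Each element of `xs` charged to `ys` consumes one occurrence there; as `xs` has no
  -- repetitions, the later ones still find theirs. No inclusion between the lists is required.
  ∑-≤-overlap : ∀ {xs} (ys : List A) {f} g k → Unique xs →
    (∀ {x} → x ∈ xs → (x ∈ ys × f x ℕ.≤ g x ℕ.+ k x) ⊎ f x ℕ.≤ k x) →
    ∑ xs f ℕ.≤ ∑ ys g ℕ.+ ∑ xs k
  ∑-≤-overlap {[]}     ys g k _          f≤ = z≤n
  ∑-≤-overlap {x ∷ xs} ys {f} g k (x∉xs ∷ u) f≤ with f≤ (here refl)
  ... | inj₂ fx≤kx = begin
    f x ℕ.+ ∑ xs f                   ≤⟨ ℕ.+-mono-≤ fx≤kx (∑-≤-overlap ys g k u (λ x∈ → f≤ (there x∈))) ⟩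
    k x ℕ.+ (∑ ys g ℕ.+ ∑ xs k)      ≡⟨ x∙yz≈y∙xz (k x) (∑ ys g) (∑ xs k) ⟩
    ∑ ys g ℕ.+ (k x ℕ.+ ∑ xs k)      ∎
    where open ℕ.≤-Reasoning
  ... | inj₁ (x∈ys , fx≤) with ∈-∃++ x∈ys
  ...   | ps , qs , refl = begin
    f x ℕ.+ ∑ xs f                               ≤⟨ ℕ.+-mono-≤ fx≤ (∑-≤-overlap (ps ++ qs) g k u f≤′) ⟩
    g x ℕ.+ k x ℕ.+ (∑ (ps ++ qs) g ℕ.+ ∑ xs k)  ≡⟨ interchange (g x) (k x) (∑ (ps ++ qs) g) (∑ xs k) ⟩
    g x ℕ.+ ∑ (ps ++ qs) g ℕ.+ (k x ℕ.+ ∑ xs k)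
      ≡⟨ cong (ℕ._+ (k x ℕ.+ ∑ xs k)) (sum-↭ (Perm.map⁺ g (Perm.shift x ps qs))) ⟨
    ∑ (ps ++ x ∷ qs) g ℕ.+ (k x ℕ.+ ∑ xs k)      ∎
    where
    open ℕ.≤-Reasoning
    remove : ∀ {y} → y ∈ xs → y ∈ ps ++ x ∷ qs → y ∈ ps ++ qs
    remove y∈xs y∈ with ∈-++⁻ ps y∈
    ... | inj₁ y∈ps         = ∈-++⁺ˡ y∈ps
    ... | inj₂ (here refl)  = ⊥-elim (All.lookup x∉xs y∈xs refl)
    ... | inj₂ (there y∈qs) = ∈-++⁺ʳ ps y∈qs
    f≤′ : ∀ {y} → y ∈ xs → (y ∈ ps ++ qs × f y ℕ.≤ g y ℕ.+ k y) ⊎ f y ℕ.≤ k y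
    f≤′ y∈xs with f≤ (there y∈xs)
    ... | inj₁ (y∈ , fy≤) = inj₁ (remove y∈xs y∈ , fy≤)
    ... | inj₂ fy≤        = inj₂ fy≤

  ∑-≤-support : ∀ {xs ys : List A} {f} g → Unique xs →
    (∀ {x} → x ∈ xs → (x ∈ ys × f x ℕ.≤ g x) ⊎ f x ≡ 0) → ∑ xs f ℕ.≤ ∑ ys g
  ∑-≤-support {xs} {ys} {f} g u f≤ = begin
    ∑ xs f                        ≤⟨ ∑-≤-overlap ys g (λ _ → 0) u f≤′ ⟩
    ∑ ys g ℕ.+ ∑ xs (λ _ → 0)     ≡⟨ cong (∑ ys g ℕ.+_) (trans (∑-const xs 0) (ℕ.*-zeroʳ (length xs))) ⟩
    ∑ ys g ℕ.+ 0                  ≡⟨ ℕ.+-identityʳ _ ⟩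
    ∑ ys g                        ∎
    where
    open ℕ.≤-Reasoning
    f≤′ : ∀ {x} → x ∈ xs → (x ∈ ys × f x ℕ.≤ g x ℕ.+ 0) ⊎ f x ℕ.≤ 0
    f≤′ x∈ with f≤ x∈
    ... | inj₁ (x∈ys , fx≤) = inj₁ (x∈ys , ℕ.≤-trans fx≤ (ℕ.m≤m+n _ 0))
    ... | inj₂ fx≡0         = inj₂ (ℕ.≤-reflexive fx≡0)

∑-map : ∀ {A B : Set} (h : A → B) xs f → ∑ (map h xs) f ≡ ∑ xs (λ x → f (h x))
∑-map h xs f = cong sum (sym (List.map-∘ xs))

levels-unique : ∀ ℓ₀ N → Unique (levels ℓ₀ N)
levels-unique ℓ₀ N = map⁺ (λ eq → ℤ.+-injective (∙-cancelˡ ℓ₀ _ _ eq)) (upTo⁺ N)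

length-levels : ∀ ℓ₀ N → length (levels ℓ₀ N) ≡ N
length-levels ℓ₀ N = trans (List.length-map _ (upTo N)) (List.length-upTo N)

∑-levels-const : ∀ ℓ₀ N c → ∑ (levels ℓ₀ N) (λ _ → c) ≡ N ℕ.* c
∑-levels-const ℓ₀ N c = trans (∑-const (levels ℓ₀ N) c) (cong (ℕ._* c) (length-levels ℓ₀ N))

-- Level contributions as natural numbers

approx : ℕ → ℤ → ℕ
approx s e = if s ℕ.≡ᵇ 0 then 0 else suc (scale s e)

approx-≤ : ∀ s e → approx s e ℕ.≤ suc (scale s e)
approx-≤ zero    e = z≤n
approx-≤ (suc s) e = ℕ.≤-refl

scale-mono : ∀ {s s′} e → s ℕ.≤ s′ → scale s e ℕ.≤ scale s′ e
scale-mono e s≤s′ = ℕ./-monoˡ-≤ (2 ^ neg e) {{2^≢0 (neg e)}} (ℕ.*-monoˡ-≤ (2 ^ pos e) s≤s′)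

scale-zero : ∀ e → scale 0 e ≡ 0
scale-zero e = ℕ.0/n≡0 (2 ^ neg e) {{2^≢0 (neg e)}}

approx-mono : ∀ {s s′} e → s ℕ.≤ s′ → approx s e ℕ.≤ approx s′ e
approx-mono {zero}           e s≤s′ = z≤n
approx-mono {suc s} {suc s′} e s≤s′ = s≤s (scale-mono e s≤s′)

approx-lower : ∀ s {e p q} → e ≡ + p - + q → s ℕ.* 2 ^ p ℕ.≤ approx s e ℕ.* 2 ^ q
approx-lower zero            e≡p-q = z≤n
approx-lower (suc s) {e} {p} {q} e≡p-q = ℕ.<⇒≤ (scale-upper (suc s) {e} {p} {q} e≡p-q)

module _ (s : ℕ) (e : ℤ) (d : ℕ) where
  private
    p = pos e
    q = neg e
    e-d≡ : e - + d ≡ + p - + (q ℕ.+ d)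
    e-d≡ = trans (cong (_- + d) (pos-neg e)) (assoc (+ p) (+ q) (+ d))
      where
      assoc : ∀ x y z → (x - y) - z ≡ x - (y + z)
      assoc = ℤSolver.solve-∀
    instance
      nz-q : NonZero (2 ^ q)
      nz-q = 2^≢0 q
    split : ∀ x → x ℕ.* 2 ^ (q ℕ.+ d) ≡ 2 ^ d ℕ.* x ℕ.* 2 ^ q
    split x = trans (cong (x ℕ.*_) (ℕ.^-distribˡ-+-* 2 q d)) (rearrange x (2 ^ q) (2 ^ d))
      where
      rearrange : ∀ x y z → x ℕ.* (y ℕ.* z) ≡ z ℕ.* x ℕ.* y
      rearrange = ℕSolver.solve-∀
    open ℕ.≤-Reasoning

  -- With x = s 2^e, the integer 2^d ⌊x / 2^d⌋ is at most x, hence below ⌊x⌋ + 1.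
  scale-shift-≤ : 2 ^ d ℕ.* scale s (e - + d) ℕ.≤ scale s e
  scale-shift-≤ = ℕ.m<1+n⇒m≤n (ℕ.*-cancelʳ-< (2 ^ q) _ _ (begin-strict
    2 ^ d ℕ.* scale s (e - + d) ℕ.* 2 ^ q   ≡⟨ split _ ⟨
    scale s (e - + d) ℕ.* 2 ^ (q ℕ.+ d)     ≤⟨ scale-lower s {e - + d} {p} {q ℕ.+ d} e-d≡ ⟩
    s ℕ.* 2 ^ p                             <⟨ scale-upper s {e} {p} {q} (pos-neg e) ⟩
    suc (scale s e) ℕ.* 2 ^ q               ∎))

  scale-shift-< : scale s e ℕ.< 2 ^ d ℕ.* suc (scale s (e - + d))
  scale-shift-< = ℕ.*-cancelʳ-< (2 ^ q) _ _ (begin-strict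
    scale s e ℕ.* 2 ^ q                         ≤⟨ scale-lower s {e} {p} {q} (pos-neg e) ⟩
    s ℕ.* 2 ^ p                                 <⟨ scale-upper s {e - + d} {p} {q ℕ.+ d} e-d≡ ⟩
    suc (scale s (e - + d)) ℕ.* 2 ^ (q ℕ.+ d)   ≡⟨ split _ ⟩
    2 ^ d ℕ.* suc (scale s (e - + d)) ℕ.* 2 ^ q ∎)

-- Only the floor shrinks under the shift, not the final +1: 4 (m + 1) = 4 m + 4 leaves a remainder
-- of 4 for each level.
approx-shift-≤ : ∀ s e {d} → 2 ℕ.≤ d → 4 ℕ.* approx s (e - + d) ℕ.≤ approx s e ℕ.+ 4
approx-shift-≤ zero    e     2≤d = z≤n
approx-shift-≤ (suc s) e {d} 2≤d = begin
  4 ℕ.* suc m              ≡⟨ ℕ.*-suc 4 m ⟩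
  4 ℕ.+ 4 ℕ.* m            ≤⟨ ℕ.+-monoʳ-≤ 4 (ℕ.*-monoˡ-≤ m (ℕ.^-monoʳ-≤ 2 2≤d)) ⟩
  4 ℕ.+ 2 ^ d ℕ.* m        ≤⟨ ℕ.+-monoʳ-≤ 4 (ℕ.m≤n⇒m≤1+n (scale-shift-≤ (suc s) e d)) ⟩
  4 ℕ.+ approx (suc s) e   ≡⟨ ℕ.+-comm 4 _ ⟩
  approx (suc s) e ℕ.+ 4   ∎
  where
  open ℕ.≤-Reasoning
  m = scale (suc s) (e - + d)

approx-≤-shift : ∀ s e d → approx s e ℕ.≤ 2 ^ d ℕ.* approx s (e - + d)
approx-≤-shift zero    e d = z≤n
approx-≤-shift (suc s) e d = scale-shift-< (suc s) e d

-- In its uses `b` is the precision minus one, so that `2 ^ b ≤ s` is the normalization bound of a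
-- significand.
approx-normalized : ∀ {b s L e} → 2 ^ b ℕ.≤ s → e ≡ + suc L - + suc b → 2 ^ L ℕ.≤ approx s e
approx-normalized {b} {s} {L} {e} 2^b≤s e≡ = ℕ.*-cancelʳ-≤ _ _ (2 ^ suc b) {{2^≢0 (suc b)}} (begin
  2 ^ L ℕ.* 2 ^ suc b           ≡⟨ rearrange (2 ^ L) (2 ^ b) ⟩
  2 ^ b ℕ.* 2 ^ suc L           ≤⟨ ℕ.*-monoˡ-≤ (2 ^ suc L) 2^b≤s ⟩
  s ℕ.* 2 ^ suc L               ≤⟨ approx-lower s {e} {suc L} {suc b} e≡ ⟩
  approx s e ℕ.* 2 ^ suc b      ∎)
  where
  open ℕ.≤-Reasoning
  rearrange : ∀ x y → x ℕ.* (2 ℕ.* y) ≡ y ℕ.* (2 ℕ.* x)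
  rearrange = ℕSolver.solve-∀

-- The strict bound on `s` absorbs the final +1: s 2^(p-q) < 2^p puts the floor strictly below the
-- integer 2^p.
approx-bounded : ∀ {s e k p q} → s ℕ.< 2 ^ k → e ≡ + p - + q → k ℕ.≤ q → approx s e ℕ.≤ 2 ^ p
approx-bounded {s} {e} {k} {p} {q} s<2^k e≡ k≤q = ℕ.≤-trans (approx-≤ s e)
  (ℕ.*-cancelʳ-< (2 ^ q) _ _ (begin-strict
  scale s e ℕ.* 2 ^ q       ≤⟨ scale-lower s {e} {p} {q} e≡ ⟩
  s ℕ.* 2 ^ p               <⟨ ℕ.*-monoˡ-< (2 ^ p) {{2^≢0 p}} s<2^k ⟩
  2 ^ k ℕ.* 2 ^ p           ≤⟨ ℕ.*-monoˡ-≤ (2 ^ p) (ℕ.^-monoʳ-≤ 2 k≤q) ⟩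
  2 ^ q ℕ.* 2 ^ p           ≡⟨ ℕ.*-comm (2 ^ q) (2 ^ p) ⟩
  2 ^ p ℕ.* 2 ^ q           ∎))
  where open ℕ.≤-Reasoning

-- The quantities of a configuration over the naturals

module _ {b : ℕ} {ℓ₀ : ℤ} {N : ℕ} where

  term : Configuration b ℓ₀ N → ℤ → ℤ → ℕ
  term C G j = approx (SS C j) (j + G)

  total : Configuration b ℓ₀ N → ℤ → ℕ
  total C G = ∑ (levels ℓ₀ N) (term C G)

  Aₗ≡term : ∀ C ℓ G → Aₗ C ℓ G ≡ + term C G ℓ
  Aₗ≡term C ℓ G = lemma (SS C ℓ)
    where
    lemma : ∀ s → (if s ℕ.≡ᵇ 0 then 0ℤ else floor (toℚ s ℚ.* pow2 ℓ ℚ.* pow2 G) + 1ℤ) ≡ + approx s (ℓ + G)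
    lemma zero    = refl
    lemma (suc s) = trans (cong (_+ 1ℤ) floor≡) (cong +_ (ℕ.+-comm _ 1))
      where
      floor≡ : floor (toℚ (suc s) ℚ.* pow2 ℓ ℚ.* pow2 G) ≡ + scale (suc s) (ℓ + G)
      floor≡ = trans (cong floor (trans (ℚ.*-assoc (toℚ (suc s)) (pow2 ℓ) (pow2 G))
                                        (cong (toℚ (suc s) ℚ.*_) (pow2-+ ℓ G))))
                     (floor-scale (suc s) (ℓ + G))

  A≡total : ∀ C G → A C G ≡ + total C G
  A≡total C G = sumℤ-+ (levels ℓ₀ N) (term C G) (λ ℓ → Aₗ≡term C ℓ G)

  level-or-empty : ∀ (C : Configuration b ℓ₀ N) ℓ → ℓ ∈ levels ℓ₀ N ⊎ contents C ℓ ≡ []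
  level-or-empty C ℓ with DecMembership._∈?_ ℤ._≟_ ℓ (levels ℓ₀ N)
  ... | yes ℓ∈ = inj₁ ℓ∈
  ... | no  ℓ∉ = inj₂ (outside C ℓ∉)

  term-empty : ∀ C G {ℓ} → contents C ℓ ≡ [] → term C G ℓ ≡ 0
  term-empty C G {ℓ} ∅ = cong (λ c → approx (sum c) (ℓ + G)) ∅

  -- Off the set of levels the term is 0, so no membership proof is asked of `ℓ`.
  term≤total : ∀ C G ℓ → term C G ℓ ℕ.≤ total C G
  term≤total C G ℓ = ℕ.≤-trans (ℕ.m≤m+n _ 0) (∑-≤-support {xs = ℓ ∷ []} (term C G) ([] ∷ []) support)
    where
    support : ∀ {x} → x ∈ ℓ ∷ [] → (x ∈ levels ℓ₀ N × term C G x ℕ.≤ term C G x) ⊎ term C G x ≡ 0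
    support (here refl) with level-or-empty C ℓ
    ... | inj₁ ℓ∈ = inj₁ (ℓ∈ , ℕ.≤-refl)
    ... | inj₂ ∅  = inj₂ (term-empty C G ∅)

-- Singletons, removals, and the effect of lowering the shift

module _ {b : ℕ} {ℓ₀ : ℤ} {N : ℕ} where

  A-bounds : ∀ (C : Configuration b ℓ₀ N) G {m n} →
    m ℕ.≤ total C G → total C G ℕ.< n → + m ≤ A C G × A C G < + n
  A-bounds C G {m} {n} m≤ <n rewrite A≡total C G = ℤ.+≤+ m≤ , ℤ.+<+ <n

  -- The shift moves the significand from [2^(b-1), 2^b) to [2^L₀, 2^(L₀+1)). The final +1 may reach
  -- 2^(L₀+1), which is why `suc L₀ < b` is asked for.
  singleton-bounds : ∀ {K L₀} → 1 ℕ.≤ b → K ℕ.≤ L₀ → suc L₀ ℕ.< b →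
    ∀ (C : Configuration b ℓ₀ N) top → IsSingleton C top →
    let G = + L₀ + 1ℤ - + b - top in
    2 ^ K ℕ.≤ total C G × total C G ℕ.< 2 ^ b
  singleton-bounds {K} {L₀} (s≤s {n = b-1} z≤n) K≤L₀ 1+L₀<b C top ((s , C≡[s]) , rest) = lower , upper
    where
    open ℕ.≤-Reasoning
    G = + L₀ + 1ℤ - + b - top
    exponent : top + G ≡ + suc L₀ - + b
    exponent = trans (cancel top (+ L₀ + 1ℤ) (+ b)) (cong (λ i → + i - + b) (ℕ.+-comm L₀ 1))
      where
      cancel : ∀ t x y → t + (x - y - t) ≡ x - y
      cancel = ℤSolver.solve-∀
    SS≡s : SS C top ≡ s
    SS≡s = trans (cong sum C≡[s]) (ℕ.+-identityʳ s)
    significand : IsSignificand b s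
    significand = All.head (subst (All (IsSignificand b)) C≡[s] (significands C top))
    lower : 2 ^ K ℕ.≤ total C G
    lower = begin
      2 ^ K          ≤⟨ ℕ.^-monoʳ-≤ 2 K≤L₀ ⟩
      2 ^ L₀         ≤⟨ approx-normalized {b-1} {SS C top} {L₀} {top + G}
                          (subst (2 ^ b-1 ℕ.≤_) (sym SS≡s) (proj₁ significand)) exponent ⟩
      term C G top   ≤⟨ term≤total C G top ⟩
      total C G      ∎
    support : ∀ {x} → x ∈ levels ℓ₀ N → (x ∈ top ∷ [] × term C G x ℕ.≤ term C G x) ⊎ term C G x ≡ 0
    support {x} _ with x ℤ.≟ top
    ... | yes x≡top = inj₁ (here x≡top , ℕ.≤-refl)
    ... | no  x≢top = inj₂ (term-empty C G (rest x x≢top))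
    upper : total C G ℕ.< 2 ^ b
    upper = begin-strict
      total C G            ≤⟨ ∑-≤-support {ys = top ∷ []} (term C G) (levels-unique ℓ₀ N) support ⟩
      term C G top ℕ.+ 0   ≡⟨ ℕ.+-identityʳ _ ⟩
      term C G top         ≤⟨ approx-bounded {SS C top} {top + G} {b} {suc L₀} {b}
                                (subst (ℕ._< 2 ^ b) (sym SS≡s) (proj₂ significand)) exponent ℕ.≤-refl ⟩
      2 ^ suc L₀           <⟨ ℕ.^-monoʳ-< 2 (s≤s (s≤s z≤n)) 1+L₀<b ⟩
      2 ^ b                ∎

  removal-mono : ∀ (C C′ : Configuration b ℓ₀ N) → RemovedFrom C C′ → ∀ G → total C′ G ℕ.≤ total C G
  removal-mono C C′ removed G = ∑-mono (levels ℓ₀ N) λ ℓ → approx-mono (ℓ + G) (SS′≤SS ℓ)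
    where
    open ℕ.≤-Reasoning
    SS′≤SS : ∀ ℓ → SS C′ ℓ ℕ.≤ SS C ℓ
    SS′≤SS ℓ with removed ℓ
    ... | r , C↭ = begin
      SS C′ ℓ                        ≤⟨ ℕ.m≤n+m (SS C′ ℓ) (sum r) ⟩
      sum r ℕ.+ SS C′ ℓ              ≡⟨ sum-++ r (contents C′ ℓ) ⟨
      sum (r ++ contents C′ ℓ)       ≡⟨ sum-↭ C↭ ⟨
      SS C ℓ                         ∎

  term-shift : ∀ (C : Configuration b ℓ₀ N) G d j → term C (G - + d) j ≡ approx (SS C j) (j + G - + d)
  term-shift C G d j = cong (approx (SS C j)) (sym (ℤ.+-assoc j G (ℤ.- + d)))

  term-shift-≤ : ∀ (C : Configuration b ℓ₀ N) G {d} j → 2 ℕ.≤ d →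
    4 ℕ.* term C (G - + d) j ℕ.≤ term C G j ℕ.+ 4
  term-shift-≤ C G {d} j 2≤d rewrite term-shift C G d j = approx-shift-≤ (SS C j) (j + G) 2≤d

  term-≤-shift : ∀ (C : Configuration b ℓ₀ N) G d j → term C G j ℕ.≤ 2 ^ d ℕ.* term C (G - + d) j
  term-≤-shift C G d j rewrite term-shift C G d j = approx-≤-shift (SS C j) (j + G) d

  ∑-term+4 : ∀ (C : Configuration b ℓ₀ N) G →
    ∑ (levels ℓ₀ N) (λ j → term C G j ℕ.+ 4) ≡ total C G ℕ.+ N ℕ.* 4
  ∑-term+4 C G = trans (∑-+ (levels ℓ₀ N) (term C G) (λ _ → 4))
                       (cong (total C G ℕ.+_) (∑-levels-const ℓ₀ N 4))

  total-shift-≤ : ∀ (C : Configuration b ℓ₀ N) G {d} → 2 ℕ.≤ d →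
    4 ℕ.* total C (G - + d) ℕ.≤ total C G ℕ.+ N ℕ.* 4
  total-shift-≤ C G {d} 2≤d = begin
    4 ℕ.* total C (G - + d)                           ≡⟨ ∑-* (levels ℓ₀ N) 4 (term C (G - + d)) ⟨
    ∑ (levels ℓ₀ N) (λ j → 4 ℕ.* term C (G - + d) j)
      ≤⟨ ∑-mono (levels ℓ₀ N) (λ j → term-shift-≤ C G j 2≤d) ⟩
    ∑ (levels ℓ₀ N) (λ j → term C G j ℕ.+ 4)          ≡⟨ ∑-term+4 C G ⟩
    total C G ℕ.+ N ℕ.* 4                             ∎
    where open ℕ.≤-Reasoning

  total-≤-shift : ∀ (C : Configuration b ℓ₀ N) G d → total C G ℕ.≤ 2 ^ d ℕ.* total C (G - + d)
  total-≤-shift C G d = begin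
    total C G                                            ≤⟨ ∑-mono (levels ℓ₀ N) (term-≤-shift C G d) ⟩
    ∑ (levels ℓ₀ N) (λ j → 2 ^ d ℕ.* term C (G - + d) j) ≡⟨ ∑-* (levels ℓ₀ N) (2 ^ d) (term C (G - + d)) ⟩
    2 ^ d ℕ.* total C (G - + d)                          ∎
    where open ℕ.≤-Reasoning

  N*4<2^b : ∀ {K} → N ℕ.< 2 ^ K → K ℕ.+ 2 ℕ.≤ b → N ℕ.* 4 ℕ.< 2 ^ b
  N*4<2^b {K} N<2^K K+2≤b = begin-strict
    N ℕ.* 4            <⟨ ℕ.*-monoˡ-< 4 N<2^K ⟩
    2 ^ K ℕ.* 2 ^ 2    ≡⟨ ℕ.^-distribˡ-+-* 2 K 2 ⟨
    2 ^ (K ℕ.+ 2)      ≤⟨ ℕ.^-monoʳ-≤ 2 K+2≤b ⟩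
    2 ^ b              ∎
    where open ℕ.≤-Reasoning

  -- Adding a significand

  module Added {C C′ : Configuration b ℓ₀ N} {ℓ : ℤ} (added : AddedAt ℓ C C′) where

    term-unchanged : ∀ G {j} → j ≢ ℓ → term C′ G j ≡ term C G j
    term-unchanged G {j} j≢ℓ = cong (λ s → approx s (j + G)) (sum-↭ (proj₂ added j j≢ℓ))

    -- Every other level keeps its term; at `ℓ` the old term stays on the right as harmless excess.
    total-added : ∀ G → total C′ G ℕ.≤ term C′ G ℓ ℕ.+ total C G
    total-added G = ℕ.≤-trans (∑-≤-overlap (ℓ ∷ []) (term C′ G) (term C G) (levels-unique ℓ₀ N) bound)
                              (ℕ.≤-reflexive (cong (ℕ._+ total C G) (ℕ.+-identityʳ (term C′ G ℓ))))
      where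
      bound : ∀ {j} → j ∈ levels ℓ₀ N →
        (j ∈ ℓ ∷ [] × term C′ G j ℕ.≤ term C′ G j ℕ.+ term C G j) ⊎ term C′ G j ℕ.≤ term C G j
      bound {j} _ with j ℤ.≟ ℓ
      ... | yes j≡ℓ = inj₁ (here j≡ℓ , ℕ.m≤m+n _ _)
      ... | no  j≢ℓ = inj₂ (ℕ.≤-reflexive (term-unchanged G j≢ℓ))

    -- Lowering by Δ divides the total by at most 2^Δ, and K + Δ ≤ b. Above, the total at G exceeds
    -- the limit by less than 2^b, since only level `ℓ` changed.
    small-shift : ∀ {K Δ R} → N ℕ.< 2 ^ K → 2 ℕ.≤ Δ → K ℕ.+ Δ ℕ.≤ R → R ℕ.+ 3 ℕ.≤ b →
      ∀ G → total C G ℕ.< 2 ^ b → term C′ G ℓ ℕ.< 2 ^ b → 2 ^ b ℕ.≤ total C′ G →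
      2 ^ K ℕ.≤ total C′ (G - + Δ) × total C′ (G - + Δ) ℕ.< 2 ^ b
    small-shift {K} {Δ} {R} N<2^K 2≤Δ K+Δ≤R R+3≤b G A<2^b Aₗ<2^b 2^b≤A′ = lower , upper
      where
      open ℕ.≤-Reasoning
      R≤b : R ℕ.≤ b
      R≤b = ℕ.≤-trans (ℕ.m≤m+n R 3) R+3≤b
      lower : 2 ^ K ℕ.≤ total C′ (G - + Δ)
      lower = ℕ.*-cancelˡ-≤ (2 ^ Δ) {{2^≢0 Δ}} (begin
        2 ^ Δ ℕ.* 2 ^ K                 ≡⟨ trans (ℕ.*-comm (2 ^ Δ) (2 ^ K)) (sym (ℕ.^-distribˡ-+-* 2 K Δ)) ⟩
        2 ^ (K ℕ.+ Δ)                   ≤⟨ ℕ.^-monoʳ-≤ 2 (ℕ.≤-trans K+Δ≤R R≤b) ⟩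
        2 ^ b                           ≤⟨ 2^b≤A′ ⟩
        total C′ G                      ≤⟨ total-≤-shift C′ G Δ ⟩
        2 ^ Δ ℕ.* total C′ (G - + Δ)    ∎)
      upper : total C′ (G - + Δ) ℕ.< 2 ^ b
      upper = ℕ.*-cancelˡ-< 4 _ _ (begin-strict
        4 ℕ.* total C′ (G - + Δ)                     ≤⟨ total-shift-≤ C′ G 2≤Δ ⟩
        total C′ G ℕ.+ N ℕ.* 4                       ≤⟨ ℕ.+-monoˡ-≤ (N ℕ.* 4) (total-added G) ⟩
        term C′ G ℓ ℕ.+ total C G ℕ.+ N ℕ.* 4
          <⟨ ℕ.+-mono-< (ℕ.+-mono-< Aₗ<2^b A<2^b) (N*4<2^b N<2^K K+2≤b) ⟩
        2 ^ b ℕ.+ 2 ^ b ℕ.+ 2 ^ b                    ≤⟨ ℕ.m≤m+n _ (2 ^ b) ⟩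
        2 ^ b ℕ.+ 2 ^ b ℕ.+ 2 ^ b ℕ.+ 2 ^ b          ≡⟨ four (2 ^ b) ⟩
        4 ℕ.* 2 ^ b                                  ∎)
        where
        K+2≤b : K ℕ.+ 2 ℕ.≤ b
        K+2≤b = ℕ.≤-trans (ℕ.+-monoʳ-≤ K 2≤Δ) (ℕ.≤-trans K+Δ≤R R≤b)
        four : ∀ x → x ℕ.+ x ℕ.+ x ℕ.+ x ≡ 4 ℕ.* x
        four = ℕSolver.solve-∀

    module _ {K Δ R : ℕ} (N<2^K : N ℕ.< 2 ^ K) (2≤Δ : 2 ℕ.≤ Δ) (K+Δ≤R : K ℕ.+ Δ ℕ.≤ R) (R+3≤b : R ℕ.+ 3 ℕ.≤ b)
             (G : ℤ) (A<2^b : total C G ℕ.< 2 ^ b) (2^b≤Aₗ : 2 ^ b ℕ.≤ term C′ G ℓ) where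
      private
        open ℕ.≤-Reasoning
        S = SS C′ ℓ
        k = ⌊log₂ S ⌋
        e = ℓ + G
        p = pos e
        q = neg e
        m = scale S e
        G↓ = + R - + k - ℓ
        K≤R : K ℕ.≤ R
        K≤R = ℕ.≤-trans (ℕ.m≤m+n K Δ) K+Δ≤R
        K+2≤b : K ℕ.+ 2 ℕ.≤ b
        K+2≤b = ℕ.≤-trans (ℕ.+-monoʳ-≤ K 2≤Δ) (ℕ.≤-trans K+Δ≤R (ℕ.≤-trans (ℕ.m≤m+n R 3) R+3≤b))

        2^b≤1+m : 2 ^ b ℕ.≤ suc m
        2^b≤1+m = ℕ.≤-trans 2^b≤Aₗ (approx-≤ S e)

        1≤m : 1 ℕ.≤ m
        1≤m = ℕ.m<1+n⇒m≤n (ℕ.<-≤-trans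
          (ℕ.^-monoʳ-< 2 (s≤s (s≤s z≤n)) (ℕ.<-≤-trans (s≤s z≤n) (ℕ.≤-trans (ℕ.m≤n+m 3 R) R+3≤b))) 2^b≤1+m)

        1≤S : 1 ℕ.≤ S
        1≤S = ℕ.n≢0⇒n>0 λ S≡0 → ℕ.<⇒≢ 1≤m (sym (trans (cong (λ s → scale s e) S≡0) (scale-zero e)))

        -- This is G - G↓ = e + k - R ≥ 2 with the subtractions cleared. From 2^b ≤ m + 1 ≤ 2 m ≤ 2
        -- S 2^e < 2^(k+2+e), where the +1 and the logarithm cost a factor of two each, strictness
        -- gives b ≤ k + e + 1, and R + 3 ≤ b does the rest.
        R+q+2≤k+p : R ℕ.+ q ℕ.+ 2 ℕ.≤ k ℕ.+ p
        R+q+2≤k+p = ℕ.≤-pred (begin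
          suc (R ℕ.+ q ℕ.+ 2)      ≡⟨ rearrange R q ⟩
          R ℕ.+ 3 ℕ.+ q            ≤⟨ ℕ.+-monoˡ-≤ q R+3≤b ⟩
          b ℕ.+ q                  ≤⟨ ℕ.m<1+n⇒m≤n (2^-cancel-< 2^[b+q]<) ⟩
          suc (k ℕ.+ p)            ∎)
          where
          rearrange : ∀ x y → suc (x ℕ.+ y ℕ.+ 2) ≡ x ℕ.+ 3 ℕ.+ y
          rearrange = ℕSolver.solve-∀
          2^[b+q]< : 2 ^ (b ℕ.+ q) ℕ.< 2 ^ suc (suc (k ℕ.+ p))
          2^[b+q]< = begin-strict
            2 ^ (b ℕ.+ q)                ≡⟨ ℕ.^-distribˡ-+-* 2 b q ⟩
            2 ^ b ℕ.* 2 ^ q              ≤⟨ ℕ.*-monoˡ-≤ (2 ^ q) 2^b≤1+m ⟩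
            (1 ℕ.+ m) ℕ.* 2 ^ q          ≤⟨ ℕ.*-monoˡ-≤ (2 ^ q) (ℕ.+-monoˡ-≤ m 1≤m) ⟩
            (m ℕ.+ m) ℕ.* 2 ^ q          ≡⟨ double m (2 ^ q) ⟩
            2 ℕ.* (m ℕ.* 2 ^ q)          ≤⟨ ℕ.*-monoʳ-≤ 2 (scale-lower S {e} {p} {q} (pos-neg e)) ⟩
            2 ℕ.* (S ℕ.* 2 ^ p)
              <⟨ ℕ.*-monoʳ-< 2 (ℕ.*-monoˡ-< (2 ^ p) {{2^≢0 p}} (n<2^[1+⌊log₂n⌋] S)) ⟩
            2 ℕ.* (2 ^ suc k ℕ.* 2 ^ p)  ≡⟨ cong (2 ℕ.*_) (ℕ.^-distribˡ-+-* 2 (suc k) p) ⟨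
            2 ^ suc (suc (k ℕ.+ p))      ∎
            where
            double : ∀ x y → (x ℕ.+ x) ℕ.* y ≡ 2 ℕ.* (x ℕ.* y)
            double = ℕSolver.solve-∀

        D = (k ℕ.+ p) ∸ (R ℕ.+ q)
        2≤D : 2 ℕ.≤ D
        2≤D = ℕ.m+n≤o⇒m≤o∸n 2 (subst (ℕ._≤ k ℕ.+ p) (ℕ.+-comm (R ℕ.+ q) 2) R+q+2≤k+p)

        G↓≡G-D : G↓ ≡ G - + D
        G↓≡G-D = trans (expand (+ R) (+ k) ℓ G) (cong (λ x → G - x) e+k-R≡D)
          where
          R+q≤k+p : R ℕ.+ q ℕ.≤ k ℕ.+ p
          R+q≤k+p = ℕ.≤-trans (ℕ.m≤m+n _ 2) R+q+2≤k+p
          expand : ∀ r k l g → r - k - l ≡ g - (l + g + k - r)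
          expand = ℤSolver.solve-∀
          regroup : ∀ p q k r → p - q + k - r ≡ k + p - (r + q)
          regroup = ℤSolver.solve-∀
          cancel : ∀ x y → x + y - x ≡ y
          cancel = ℤSolver.solve-∀
          e+k-R≡D : e + + k - + R ≡ + D
          e+k-R≡D =
            trans (cong (λ x → x + + k - + R) (pos-neg e))
           (trans (regroup (+ p) (+ q) (+ k) (+ R))
           (trans (cong (λ n → + n - + (R ℕ.+ q)) (sym (ℕ.m+[n∸m]≡n R+q≤k+p)))
                  (cancel (+ (R ℕ.+ q)) (+ D))))

        ℓ+G↓≡R-k : ℓ + G↓ ≡ + R - + k
        ℓ+G↓≡R-k = cancel ℓ (+ R) (+ k)
          where
          cancel : ∀ l r k → l + (r - k - l) ≡ r - k
          cancel = ℤSolver.solve-∀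

        -- The bound S < 2^(k+1) calls for writing the exponent R - k as (R + 1) - (k + 1).
        term-ℓ-≤ : term C′ G↓ ℓ ℕ.≤ 2 ^ suc R
        term-ℓ-≤ = approx-bounded {S} {ℓ + G↓} {suc k} {suc R} {suc k} (n<2^[1+⌊log₂n⌋] S)
          (trans ℓ+G↓≡R-k (shift (+ R) (+ k))) ℕ.≤-refl
          where
          shift : ∀ r k → r - k ≡ (1ℤ + r) - (1ℤ + k)
          shift = ℤSolver.solve-∀

      -- Level `ℓ` alone suffices: S ≥ 2^k gives S 2^(R-k) ≥ 2^R.
      large-shift-≥ : 2 ^ K ℕ.≤ total C′ G↓
      large-shift-≥ = begin
        2 ^ K           ≤⟨ ℕ.^-monoʳ-≤ 2 K≤R ⟩
        2 ^ R           ≤⟨ ℕ.*-cancelʳ-≤ _ _ (2 ^ k) {{2^≢0 k}} 2^R2^k≤ ⟩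
        term C′ G↓ ℓ    ≤⟨ term≤total C′ G↓ ℓ ⟩
        total C′ G↓     ∎
        where
        2^R2^k≤ : 2 ^ R ℕ.* 2 ^ k ℕ.≤ term C′ G↓ ℓ ℕ.* 2 ^ k
        2^R2^k≤ = begin
          2 ^ R ℕ.* 2 ^ k           ≡⟨ ℕ.*-comm (2 ^ R) (2 ^ k) ⟩
          2 ^ k ℕ.* 2 ^ R           ≤⟨ ℕ.*-monoˡ-≤ (2 ^ R) (2^⌊log₂n⌋≤n S 1≤S) ⟩
          S ℕ.* 2 ^ R               ≤⟨ approx-lower S {ℓ + G↓} {R} {k} ℓ+G↓≡R-k ⟩
          term C′ G↓ ℓ ℕ.* 2 ^ k    ∎

      large-shift-< : total C′ G↓ ℕ.< 2 ^ b
      large-shift-< = ℕ.*-cancelˡ-< 4 _ _ (begin-strict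
        4 ℕ.* total C′ G↓                                  ≡⟨ ∑-* (levels ℓ₀ N) 4 (term C′ G↓) ⟨
        ∑ (levels ℓ₀ N) (λ j → 4 ℕ.* term C′ G↓ j)
          ≤⟨ ∑-≤-overlap (ℓ ∷ []) (λ _ → 4 ℕ.* 2 ^ suc R) (λ j → term C G j ℕ.+ 4) (levels-unique ℓ₀ N) bound ⟩
        4 ℕ.* 2 ^ suc R ℕ.+ 0 ℕ.+ ∑ (levels ℓ₀ N) (λ j → term C G j ℕ.+ 4)
                                                           ≡⟨ cong₂ ℕ._+_ 4*2^[1+R]≡2^[R+3] (∑-term+4 C G) ⟩
        2 ^ (R ℕ.+ 3) ℕ.+ (total C G ℕ.+ N ℕ.* 4)
          <⟨ ℕ.+-mono-≤-< (ℕ.^-monoʳ-≤ 2 R+3≤b) (ℕ.+-mono-< A<2^b (N*4<2^b N<2^K K+2≤b)) ⟩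
        2 ^ b ℕ.+ (2 ^ b ℕ.+ 2 ^ b)                        ≤⟨ ℕ.m≤m+n _ (2 ^ b) ⟩
        2 ^ b ℕ.+ (2 ^ b ℕ.+ 2 ^ b) ℕ.+ 2 ^ b              ≡⟨ four (2 ^ b) ⟩
        4 ℕ.* 2 ^ b                                        ∎)
        where
        four : ∀ x → x ℕ.+ (x ℕ.+ x) ℕ.+ x ≡ 4 ℕ.* x
        four = ℕSolver.solve-∀
        4*2^[1+R]≡2^[R+3] : 4 ℕ.* 2 ^ suc R ℕ.+ 0 ≡ 2 ^ (R ℕ.+ 3)
        4*2^[1+R]≡2^[R+3] = trans (eight (2 ^ R)) (sym (ℕ.^-distribˡ-+-* 2 R 3))
          where
          eight : ∀ x → 4 ℕ.* (2 ℕ.* x) ℕ.+ 0 ≡ x ℕ.* 8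
          eight = ℕSolver.solve-∀
        bound : ∀ {j} → j ∈ levels ℓ₀ N →
          (j ∈ ℓ ∷ [] × 4 ℕ.* term C′ G↓ j ℕ.≤ 4 ℕ.* 2 ^ suc R ℕ.+ (term C G j ℕ.+ 4))
          ⊎ 4 ℕ.* term C′ G↓ j ℕ.≤ term C G j ℕ.+ 4
        bound {j} _ with j ℤ.≟ ℓ
        ... | yes refl = inj₁ (here refl , ℕ.≤-trans (ℕ.*-monoʳ-≤ 4 term-ℓ-≤) (ℕ.m≤m+n _ _))
        ... | no  j≢ℓ  = inj₂ (begin
          4 ℕ.* term C′ G↓ j             ≡⟨ cong (λ g → 4 ℕ.* term C′ g j) G↓≡G-D ⟩
          4 ℕ.* term C′ (G - + D) j      ≤⟨ term-shift-≤ C′ G j 2≤D ⟩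
          term C′ G j ℕ.+ 4              ≡⟨ cong (ℕ._+ 4) (term-unchanged G j≢ℓ) ⟩
          term C G j ℕ.+ 4               ∎)

-- The upward shift

∑-1∸n≤1 : ∀ n → ∑ (upTo n) (1 ∸_) ℕ.≤ 1
∑-1∸n≤1 zero    = z≤n
∑-1∸n≤1 (suc n) = s≤s (ℕ.≤-reflexive tail≡0)
  where
  tail≡0 : ∑ (applyUpTo suc n) (1 ∸_) ≡ 0
  tail≡0 = begin
    sum (map (1 ∸_) (applyUpTo suc n))   ≡⟨ cong (λ xs → sum (map (1 ∸_) xs)) (List.map-upTo suc n) ⟨
    ∑ (map suc (upTo n)) (1 ∸_)          ≡⟨ ∑-map suc (upTo n) (1 ∸_) ⟩
    ∑ (upTo n) (0 ∸_)                    ≡⟨ ∑-cong (upTo n) ℕ.0∸n≡0 ⟩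
    ∑ (upTo n) (λ _ → 0)                 ≡⟨ trans (∑-const (upTo n) 0) (ℕ.*-zeroʳ (length (upTo n))) ⟩
    0                                    ∎
    where open ≡-Reasoning

sum-≤-length : ∀ {n xs} → All (ℕ._≤ n) xs → sum xs ℕ.≤ n ℕ.* length xs
sum-≤-length {n} []                   = z≤n
sum-≤-length {n} {x ∷ xs} (x≤n ∷ ≤n) = begin
  x ℕ.+ sum xs                 ≤⟨ ℕ.+-mono-≤ x≤n (sum-≤-length ≤n) ⟩
  n ℕ.+ n ℕ.* length xs        ≡⟨ ℕ.*-suc n (length xs) ⟨
  n ℕ.* suc (length xs)        ∎
  where open ℕ.≤-Reasoning

-- The slack 1 ∸ r comes from r = 0, where s < 2^b (h + 2) / 2 is best possible;
-- for r > 0 parity improves 2Q < 2^r (h + 1) to Q + 1 ≤ 2^(r - 1) (h + 1).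
scale-quotient : ∀ b s r {e} → e ≡ + 1 - + r →
  2 ℕ.* s ℕ.≤ 2 ^ b ℕ.* (2 ^ r ℕ.* (scale (ℕ._/_ s (2 ^ b) {{2^≢0 b}}) e ℕ.+ 1 ℕ.+ (1 ∸ r)))
scale-quotient b s r {e} e≡ = begin
  2 ℕ.* s                               ≤⟨ ℕ.*-monoʳ-≤ 2 (ℕ.<⇒≤ s<) ⟩
  2 ℕ.* (suc Q ℕ.* 2 ^ b)               ≡⟨ rearrange (suc Q) (2 ^ b) ⟩
  2 ^ b ℕ.* (2 ℕ.* suc Q)               ≤⟨ ℕ.*-monoʳ-≤ (2 ^ b) (step r (scale-upper Q {e} {1} {r} e≡)) ⟩
  2 ^ b ℕ.* (2 ^ r ℕ.* (h ℕ.+ 1 ℕ.+ (1 ∸ r))) ∎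
  where
  open ℕ.≤-Reasoning
  instance
    nz : NonZero (2 ^ b)
    nz = 2^≢0 b
  Q = s ℕ./ (2 ^ b)
  h = scale Q e
  s< : s ℕ.< suc Q ℕ.* 2 ^ b
  s< = begin-strict
    s                                     ≡⟨ ℕ.m≡m%n+[m/n]*n s (2 ^ b) ⟩
    s ℕ.% (2 ^ b) ℕ.+ Q ℕ.* 2 ^ b         <⟨ ℕ.+-monoˡ-< (Q ℕ.* 2 ^ b) (ℕ.m%n<n s (2 ^ b)) ⟩
    suc Q ℕ.* 2 ^ b                       ∎
  rearrange : ∀ x y → 2 ℕ.* (x ℕ.* y) ≡ y ℕ.* (2 ℕ.* x)
  rearrange = ℕSolver.solve-∀
  step : ∀ r → Q ℕ.* 2 ℕ.< suc h ℕ.* 2 ^ r → 2 ℕ.* suc Q ℕ.≤ 2 ^ r ℕ.* (h ℕ.+ 1 ℕ.+ (1 ∸ r))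
  step zero lt = begin
    2 ℕ.* suc Q                    ≡⟨ lhs Q ⟩
    suc (Q ℕ.* 2) ℕ.+ 1            ≤⟨ ℕ.+-monoˡ-≤ 1 lt ⟩
    suc h ℕ.* 1 ℕ.+ 1              ≡⟨ rhs h ⟩
    1 ℕ.* (h ℕ.+ 1 ℕ.+ 1)          ∎
    where
    lhs : ∀ x → 2 ℕ.* (1 ℕ.+ x) ≡ 1 ℕ.+ x ℕ.* 2 ℕ.+ 1
    lhs = ℕSolver.solve-∀
    rhs : ∀ x → (1 ℕ.+ x) ℕ.* 1 ℕ.+ 1 ≡ 1 ℕ.* (x ℕ.+ 1 ℕ.+ 1)
    rhs = ℕSolver.solve-∀
  step (suc r) lt = begin
    2 ℕ.* suc Q
      ≤⟨ ℕ.*-monoʳ-≤ 2 (ℕ.*-cancelʳ-< 2 Q (suc h ℕ.* 2 ^ r) (begin-strict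
        Q ℕ.* 2                            <⟨ lt ⟩
        suc h ℕ.* (2 ℕ.* 2 ^ r)            ≡⟨ lhs (suc h) (2 ^ r) ⟩
        suc h ℕ.* 2 ^ r ℕ.* 2              ∎)) ⟩
    2 ℕ.* (suc h ℕ.* 2 ^ r)                ≡⟨ rhs h (2 ^ r) ⟩
    2 ^ suc r ℕ.* (h ℕ.+ 1 ℕ.+ 0)          ≡⟨ cong (λ x → 2 ^ suc r ℕ.* (h ℕ.+ 1 ℕ.+ x)) (ℕ.0∸n≡0 r) ⟨
    2 ^ suc r ℕ.* (h ℕ.+ 1 ℕ.+ (0 ∸ r))    ∎
    where
    lhs : ∀ x y → x ℕ.* (2 ℕ.* y) ≡ x ℕ.* y ℕ.* 2
    lhs = ℕSolver.solve-∀
    rhs : ∀ x y → 2 ℕ.* ((1 ℕ.+ x) ℕ.* y) ≡ 2 ℕ.* y ℕ.* (x ℕ.+ 1 ℕ.+ 0)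
    rhs = ℕSolver.solve-∀

i-[i-j]≡j : ∀ i j → i - (i - j) ≡ j
i-[i-j]≡j = ℤSolver.solve-∀

module Raise {b : ℕ} {ℓ₀ : ℤ} {N : ℕ} (C : Configuration b ℓ₀ N) (top : ℤ) where
  private
    open ℕ.≤-Reasoning
    instance
      nz-b : NonZero (2 ^ b)
      nz-b = 2^≢0 b
    -- E is reindexed by levels: for j = top - r the exponent j - top + 1 equals 1 - r. Its summands
    -- can then be compared with the terms of A level by level.
    H′ : ℤ → ℕ
    H′ j = SS C j ℕ./ (2 ^ b)
    h : ℤ → ℕ
    h j = scale (H′ j) (j - top + 1ℤ)
    window : List ℤ
    window = map (λ r → top - + r) (upTo (suc b))
    ε : ℕ
    ε = ∑ window h

  E≡ε : E C top ≡ + ε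
  E≡ε = trans
    (sumℤ-+ (upTo (suc b)) (λ r → scale (H C top r) (ℤ.- + r + 1ℤ)) (λ r → floor-scale (H C top r) (ℤ.- + r + 1ℤ)))
    (cong +_ (sym (trans (∑-map (λ r → top - + r) (upTo (suc b)) h)
                         (∑-cong (upTo (suc b)) λ r → cong (λ e → scale (H C top r) (e + 1ℤ)) (cancel top (+ r))))))
    where
    cancel : ∀ x y → x - y - x ≡ ℤ.- y
    cancel = ℤSolver.solve-∀

  t≡log : t C top ≡ ⌊log₂ ε ℕ.⊔ 1 ⌋
  t≡log = cong (λ i → ⌊log₂ ℤ.∣ i ℤ.⊔ 1ℤ ∣ ⌋) E≡ε

  2^t≤ε⊔1 : 2 ^ t C top ℕ.≤ ε ℕ.⊔ 1
  2^t≤ε⊔1 = subst (λ x → 2 ^ x ℕ.≤ ε ℕ.⊔ 1) (sym t≡log) (2^⌊log₂n⌋≤n (ε ℕ.⊔ 1) (ℕ.m≤n⊔m ε 1))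

  ε<2*2^t : ε ℕ.< 2 ℕ.* 2 ^ t C top
  ε<2*2^t = subst (λ x → ε ℕ.< 2 ^ suc x) (sym t≡log)
           (ℕ.≤-<-trans (ℕ.m≤m⊔n ε 1) (n<2^[1+⌊log₂n⌋] (ε ℕ.⊔ 1)))

  -- Of `t C top` only its two bounding inequalities matter, so it is replaced by an abstract `τ`.
  module Shift (largest : LargestNonempty C top) (L : ℕ) (2≤b : 2 ℕ.≤ b)
               (τ : ℕ) (T≤ε⊔1 : 2 ^ τ ℕ.≤ ε ℕ.⊔ 1) (ε<2T : ε ℕ.< 2 ℕ.* 2 ^ τ) where
    private
      G↑ = + L + 1ℤ - + b - + τ - top
      T = 2 ^ τ
      X = 2 ^ L
      B = 2 ^ b ℕ.* 2 ^ b

    window-unique : Unique window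
    window-unique = map⁺ (λ {i} {j} eq → ℤ.+-injective (ℤ.neg-injective (∙-cancelˡ top _ _ eq))) (upTo⁺ (suc b))

    -- The exponent splits as (j - top + 1) + (L - b - τ). The factor 2^(-b) is absorbed by SS ≥ 2^b
    -- H′, which leaves at least h 2^(L-τ).
    h-≤-term : ∀ j → X ℕ.* h j ℕ.≤ T ℕ.* term C G↑ j
    h-≤-term j = ℕ.*-cancelʳ-≤ _ _ (2 ^ q ℕ.* 2 ^ b) {{ℕ.m*n≢0 (2 ^ q) (2 ^ b) {{2^≢0 q}}}} (begin
      X ℕ.* h j ℕ.* (2 ^ q ℕ.* 2 ^ b)              ≡⟨ lhs X (h j) (2 ^ q) (2 ^ b) ⟩
      X ℕ.* 2 ^ b ℕ.* (h j ℕ.* 2 ^ q)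
        ≤⟨ ℕ.*-monoʳ-≤ (X ℕ.* 2 ^ b) (scale-lower (H′ j) {j - top + 1ℤ} {p} {q} (pos-neg _)) ⟩
      X ℕ.* 2 ^ b ℕ.* (H′ j ℕ.* 2 ^ p)             ≡⟨ mid X (2 ^ b) (H′ j) (2 ^ p) ⟩
      H′ j ℕ.* 2 ^ b ℕ.* (2 ^ p ℕ.* X)
        ≤⟨ ℕ.*-monoˡ-≤ (2 ^ p ℕ.* X) (ℕ.m/n*n≤m (SS C j) (2 ^ b)) ⟩
      SS C j ℕ.* (2 ^ p ℕ.* X)                     ≡⟨ cong (SS C j ℕ.*_) (ℕ.^-distribˡ-+-* 2 p L) ⟨
      SS C j ℕ.* 2 ^ (p ℕ.+ L)
        ≤⟨ approx-lower (SS C j) {j + G↑} {p ℕ.+ L} {q ℕ.+ b ℕ.+ τ} exponent ⟩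
      term C G↑ j ℕ.* 2 ^ (q ℕ.+ b ℕ.+ τ)
        ≡⟨ cong (term C G↑ j ℕ.*_) (trans (ℕ.^-distribˡ-+-* 2 (q ℕ.+ b) τ) (cong (ℕ._* T) (ℕ.^-distribˡ-+-* 2 q b))) ⟩
      term C G↑ j ℕ.* (2 ^ q ℕ.* 2 ^ b ℕ.* T)      ≡⟨ rhs (term C G↑ j) (2 ^ q ℕ.* 2 ^ b) T ⟩
      T ℕ.* term C G↑ j ℕ.* (2 ^ q ℕ.* 2 ^ b)      ∎)
      where
      p = pos (j - top + 1ℤ)
      q = neg (j - top + 1ℤ)
      lhs : ∀ x h q b → x ℕ.* h ℕ.* (q ℕ.* b) ≡ x ℕ.* b ℕ.* (h ℕ.* q)
      lhs = ℕSolver.solve-∀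
      mid : ∀ x b h p → x ℕ.* b ℕ.* (h ℕ.* p) ≡ h ℕ.* b ℕ.* (p ℕ.* x)
      mid = ℕSolver.solve-∀
      rhs : ∀ a x t → a ℕ.* (x ℕ.* t) ≡ t ℕ.* a ℕ.* x
      rhs = ℕSolver.solve-∀
      split : ∀ j l b t k → j + (l + 1ℤ - b - t - k) ≡ (j - k + 1ℤ) + (l - b - t)
      split = ℤSolver.solve-∀
      join : ∀ p q l b t → (p - q) + (l - b - t) ≡ (p + l) - (q + b + t)
      join = ℤSolver.solve-∀
      exponent : j + G↑ ≡ + (p ℕ.+ L) - + (q ℕ.+ b ℕ.+ τ)
      exponent = trans (split j (+ L) (+ b) (+ τ) top)
        (trans (cong (_+ (+ L - + b - + τ)) (pos-neg (j - top + 1ℤ))) (join (+ p) (+ q) (+ L) (+ b) (+ τ)))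

    -- A window level that is not stored is empty, and then `h-≤-term` itself forces its summand to
    -- vanish.
    Xε≤T*total : X ℕ.* ε ℕ.≤ T ℕ.* total C G↑
    Xε≤T*total = begin
      X ℕ.* ε                                             ≡⟨ ∑-* window X h ⟨
      ∑ window (λ j → X ℕ.* h j)
        ≤⟨ ∑-≤-support {xs = window} {levels ℓ₀ N} {λ j → X ℕ.* h j} (λ j → T ℕ.* term C G↑ j) window-unique support ⟩
      ∑ (levels ℓ₀ N) (λ j → T ℕ.* term C G↑ j)           ≡⟨ ∑-* (levels ℓ₀ N) T (term C G↑) ⟩
      T ℕ.* total C G↑                                    ∎
      where
      support : ∀ {j} → j ∈ window →
        (j ∈ levels ℓ₀ N × X ℕ.* h j ℕ.≤ T ℕ.* term C G↑ j) ⊎ X ℕ.* h j ≡ 0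
      support {j} _ with level-or-empty C j
      ... | inj₁ j∈ = inj₁ (j∈ , h-≤-term j)
      ... | inj₂ ∅  = inj₂ (ℕ.n≤0⇒n≡0 (begin
        X ℕ.* h j            ≤⟨ h-≤-term j ⟩
        T ℕ.* term C G↑ j    ≡⟨ trans (cong (T ℕ.*_) (term-empty C G↑ ∅)) (ℕ.*-zeroʳ T) ⟩
        0                    ∎))

    2^[b∸1]≤SS : 2 ^ (b ∸ 1) ℕ.≤ SS C top
    2^[b∸1]≤SS with contents C top | significands C top | proj₁ largest
    ... | []     | _       | ≢[] = ⊥-elim (≢[] refl)
    ... | s ∷ ss | sig ∷ _ | _   = ℕ.≤-trans (proj₁ sig) (ℕ.m≤m+n s (sum ss))

    total-≥ : X ℕ.≤ total C G↑
    total-≥ with ε ℕ.≟ 0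
    ... | no ε≢0 = ℕ.*-cancelˡ-≤ T {{2^≢0 τ}} (begin
      T ℕ.* X             ≡⟨ ℕ.*-comm T X ⟩
      X ℕ.* T             ≤⟨ ℕ.*-monoʳ-≤ X T≤ε⊔1 ⟩
      X ℕ.* (ε ℕ.⊔ 1)     ≡⟨ cong (X ℕ.*_) (ℕ.m≥n⇒m⊔n≡m (ℕ.n≢0⇒n>0 ε≢0)) ⟩
      X ℕ.* ε             ≤⟨ Xε≤T*total ⟩
      T ℕ.* total C G↑    ∎)
    -- Here T ≤ 1 forces τ = 0, so the exponent at `top` is L + 1 - b, as for a single significand.
    ... | yes ε≡0 = ℕ.≤-trans (approx-normalized {b ∸ 1} {SS C top} {L} {top + G↑} 2^[b∸1]≤SS exponent) (term≤total C G↑ top)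
      where
      τ≡0 : τ ≡ 0
      τ≡0 = ℕ.n<1⇒n≡0 (2^-cancel-< {τ} {1} (s≤s (subst (λ x → T ℕ.≤ x ℕ.⊔ 1) ε≡0 T≤ε⊔1)))
      cancel : ∀ k l b t → k + (l + 1ℤ - b - t - k) ≡ (1ℤ + l) - b - t
      cancel = ℤSolver.solve-∀
      exponent : top + G↑ ≡ + suc L - + suc (b ∸ 1)
      exponent = trans (cancel top (+ L) (+ b) (+ τ))
        (trans (cong (λ x → + suc L - + b - + x) τ≡0)
        (trans (ℤ.+-identityʳ _)
               (cong (λ x → + suc L - + x) (sym (ℕ.m+[n∸m]≡n (ℕ.≤-trans (s≤s z≤n) 2≤b))))))

    private
      m : ℤ → ℕ
      m j = scale (SS C j) (j + G↑)

    module _ (r : ℕ) {j : ℤ} (j≡ : j ≡ top - + r) where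
      private
        exponent : j + G↑ ≡ + suc L - + (r ℕ.+ b ℕ.+ τ)
        exponent = trans (cong (_+ G↑) j≡) (cancel top (+ r) (+ L) (+ b) (+ τ))
          where
          cancel : ∀ k r l b t → (k - r) + (l + 1ℤ - b - t - k) ≡ (1ℤ + l) - (r + b + t)
          cancel = ℤSolver.solve-∀
        m-≤ : m j ℕ.* (2 ^ r ℕ.* 2 ^ b ℕ.* T) ℕ.≤ SS C j ℕ.* (2 ℕ.* X)
        m-≤ = begin
          m j ℕ.* (2 ^ r ℕ.* 2 ^ b ℕ.* T)
            ≡⟨ cong (m j ℕ.*_) (trans (ℕ.^-distribˡ-+-* 2 (r ℕ.+ b) τ) (cong (ℕ._* T) (ℕ.^-distribˡ-+-* 2 r b))) ⟨
          m j ℕ.* 2 ^ (r ℕ.+ b ℕ.+ τ)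
            ≤⟨ scale-lower (SS C j) {j + G↑} {suc L} {r ℕ.+ b ℕ.+ τ} exponent ⟩
          SS C j ℕ.* (2 ℕ.* X)              ∎

      scale-near : T ℕ.* m j ℕ.≤ X ℕ.* (h j ℕ.+ 1 ℕ.+ (1 ∸ r))
      scale-near = ℕ.*-cancelʳ-≤ _ _ (2 ^ r ℕ.* 2 ^ b) {{ℕ.m*n≢0 (2 ^ r) (2 ^ b) {{2^≢0 r}}}} (begin
        T ℕ.* m j ℕ.* (2 ^ r ℕ.* 2 ^ b)                          ≡⟨ lhs T (m j) (2 ^ r ℕ.* 2 ^ b) ⟩
        m j ℕ.* (2 ^ r ℕ.* 2 ^ b ℕ.* T)                          ≤⟨ m-≤ ⟩
        SS C j ℕ.* (2 ℕ.* X)                                     ≡⟨ mid (SS C j) X ⟩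
        X ℕ.* (2 ℕ.* SS C j)
          ≤⟨ ℕ.*-monoʳ-≤ X (scale-quotient b (SS C j) r {j - top + 1ℤ} e≡) ⟩
        X ℕ.* (2 ^ b ℕ.* (2 ^ r ℕ.* (h j ℕ.+ 1 ℕ.+ (1 ∸ r))))
          ≡⟨ rhs X (2 ^ b) (2 ^ r) (h j ℕ.+ 1 ℕ.+ (1 ∸ r)) ⟩
        X ℕ.* (h j ℕ.+ 1 ℕ.+ (1 ∸ r)) ℕ.* (2 ^ r ℕ.* 2 ^ b)      ∎)
        where
        lhs : ∀ t m y → t ℕ.* m ℕ.* y ≡ m ℕ.* (y ℕ.* t)
        lhs = ℕSolver.solve-∀
        mid : ∀ s x → s ℕ.* (2 ℕ.* x) ≡ x ℕ.* (2 ℕ.* s)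
        mid = ℕSolver.solve-∀
        rhs : ∀ x b r u → x ℕ.* (b ℕ.* (r ℕ.* u)) ≡ x ℕ.* u ℕ.* (r ℕ.* b)
        rhs = ℕSolver.solve-∀
        e≡ : j - top + 1ℤ ≡ + 1 - + r
        e≡ = trans (cong (λ i → i - top + 1ℤ) j≡) (cancel top (+ r))
          where
          cancel : ∀ k r → k - r - k + 1ℤ ≡ 1ℤ - r
          cancel = ℤSolver.solve-∀

      -- For r ≥ b + 1 the exponent is at most L - 2b - τ. The factor `B` clears 2^(-2b), and since
      -- all significands together sum to at most `B`, the far levels jointly cost one unit X / T.
      scale-far : b ℕ.< r → B ℕ.* T ℕ.* m j ℕ.≤ X ℕ.* SS C j
      scale-far b<r = ℕ.*-cancelˡ-≤ 2 (begin
        2 ℕ.* (B ℕ.* T ℕ.* m j)             ≡⟨ lhs (2 ^ b) T (m j) ⟩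
        m j ℕ.* (2 ^ suc b ℕ.* 2 ^ b ℕ.* T)
          ≤⟨ ℕ.*-monoʳ-≤ (m j) (ℕ.*-monoˡ-≤ T (ℕ.*-monoˡ-≤ (2 ^ b) (ℕ.^-monoʳ-≤ 2 b<r))) ⟩
        m j ℕ.* (2 ^ r ℕ.* 2 ^ b ℕ.* T)     ≤⟨ m-≤ ⟩
        SS C j ℕ.* (2 ℕ.* X)                ≡⟨ rhs (SS C j) X ⟩
        2 ℕ.* (X ℕ.* SS C j)                ∎)
        where
        lhs : ∀ b t m → 2 ℕ.* (b ℕ.* b ℕ.* t ℕ.* m) ≡ m ℕ.* (2 ℕ.* b ℕ.* b ℕ.* t)
        lhs = ℕSolver.solve-∀
        rhs : ∀ s x → s ℕ.* (2 ℕ.* x) ≡ 2 ℕ.* (x ℕ.* s)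
        rhs = ℕSolver.solve-∀

    private
      -- The allowance of `scale-near`, with r recovered from the level as its distance to `top`.
      w : ℤ → ℕ
      w j = h j ℕ.+ 1 ℕ.+ (1 ∸ ℤ.∣ top - j ∣)


    ∑w≤ : ∑ window w ℕ.≤ ε ℕ.+ suc b ℕ.+ 1
    ∑w≤ = begin
      ∑ window w
        ≡⟨ ∑-+ window (λ j → h j ℕ.+ 1) (λ j → 1 ∸ ℤ.∣ top - j ∣) ⟩
      ∑ window (λ j → h j ℕ.+ 1) ℕ.+ ∑ window (λ j → 1 ∸ ℤ.∣ top - j ∣)
                                                              ≡⟨ cong₂ ℕ._+_ (trans (∑-+ window h (λ _ → 1)) (cong (ε ℕ.+_) ∑1)) ∑-slack ⟩
      ε ℕ.+ suc b ℕ.+ ∑ (upTo (suc b)) (1 ∸_)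
        ≤⟨ ℕ.+-monoʳ-≤ (ε ℕ.+ suc b) (∑-1∸n≤1 (suc b)) ⟩
      ε ℕ.+ suc b ℕ.+ 1                                       ∎
      where
      ∑1 : ∑ window (λ _ → 1) ≡ suc b
      ∑1 = trans (∑-const window 1) (trans (ℕ.*-identityʳ _) (trans (List.length-map (λ r → top - + r) (upTo (suc b))) (List.length-upTo (suc b))))
      ∑-slack : ∑ window (λ j → 1 ∸ ℤ.∣ top - j ∣) ≡ ∑ (upTo (suc b)) (1 ∸_)
      ∑-slack = trans (∑-map (λ r → top - + r) (upTo (suc b)) (λ j → 1 ∸ ℤ.∣ top - j ∣))
                      (∑-cong (upTo (suc b)) λ r → cong (λ i → 1 ∸ ℤ.∣ i ∣) (i-[i-j]≡j top (+ r)))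

    ∑SS≤B : ∑ (levels ℓ₀ N) (SS C) ℕ.≤ B
    ∑SS≤B = begin
      ∑ (levels ℓ₀ N) (SS C)
        ≤⟨ ∑-mono (levels ℓ₀ N) (λ j → sum-≤-length (All.map (λ sig → ℕ.<⇒≤ (proj₂ sig)) (significands C j))) ⟩
      ∑ (levels ℓ₀ N) (λ j → 2 ^ b ℕ.* length (contents C j))
        ≡⟨ ∑-* (levels ℓ₀ N) (2 ^ b) (λ j → length (contents C j)) ⟩
      2 ^ b ℕ.* z C                                             ≤⟨ ℕ.*-monoʳ-≤ (2 ^ b) (ℕ.<⇒≤ (z<2^b C)) ⟩
      B                                                         ∎

    -- Window levels also receive the allowance X SS of the far levels, so that it can be summed
    -- over all levels and bounded by `∑SS≤B`.
    m-bound : ∀ {j} → j ∈ levels ℓ₀ N →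
      (j ∈ window × B ℕ.* T ℕ.* m j ℕ.≤ B ℕ.* X ℕ.* w j ℕ.+ X ℕ.* SS C j) ⊎ B ℕ.* T ℕ.* m j ℕ.≤ X ℕ.* SS C j
    m-bound {j} _ with top ℤ.<? j
    ... | yes top<j = inj₂ (subst (ℕ._≤ X ℕ.* SS C j) (sym BTm≡0) z≤n)
      where
      BTm≡0 : B ℕ.* T ℕ.* m j ≡ 0
      BTm≡0 = trans (cong (λ c → B ℕ.* T ℕ.* scale (sum c) (j + G↑)) (proj₂ largest j top<j))
                    (trans (cong (B ℕ.* T ℕ.*_) (scale-zero (j + G↑))) (ℕ.*-zeroʳ (B ℕ.* T)))
    ... | no top≮j with ℤ.∣ top - j ∣ ℕ.≤? b | distance
      where
      distance : j ≡ top - + ℤ.∣ top - j ∣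
      distance = sym (trans (cong (λ i → top - i) (ℤ.0≤i⇒+∣i∣≡i (ℤ.i≤j⇒0≤j-i (ℤ.≮⇒≥ top≮j)))) (i-[i-j]≡j top j))
    ...   | no  ≰b | j≡ = inj₂ (scale-far _ j≡ (ℕ.≰⇒> ≰b))
    ...   | yes ≤b | j≡ = inj₁ (subst (_∈ window) (sym j≡) (∈-map⁺ (λ r → top - + r) (∈-upTo⁺ (s≤s ≤b))) , (begin
      B ℕ.* T ℕ.* m j                       ≡⟨ ℕ.*-assoc B T (m j) ⟩
      B ℕ.* (T ℕ.* m j)                     ≤⟨ ℕ.*-monoʳ-≤ B (scale-near _ j≡) ⟩
      B ℕ.* (X ℕ.* w j)                     ≡⟨ ℕ.*-assoc B X (w j) ⟨
      B ℕ.* X ℕ.* w j                       ≤⟨ ℕ.m≤m+n _ _ ⟩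
      B ℕ.* X ℕ.* w j ℕ.+ X ℕ.* SS C j      ∎))

    -- In units of X / T: ε from the floors, b + 1 for rounding, one for r = 0 and one for the far
    -- levels. Then ε + 1 ≤ 2 T and b + 2 ≤ (b + 2) T add up to (b + 4) T.
    ∑m≤ : ∑ (levels ℓ₀ N) m ℕ.≤ X ℕ.* (b ℕ.+ 4)
    ∑m≤ = ℕ.*-cancelˡ-≤ (B ℕ.* T) {{ℕ.m*n≢0 B T {{ℕ.m*n≢0 (2 ^ b) (2 ^ b)}} {{2^≢0 τ}}}} (begin
      B ℕ.* T ℕ.* ∑ (levels ℓ₀ N) m                               ≡⟨ ∑-* (levels ℓ₀ N) (B ℕ.* T) m ⟨
      ∑ (levels ℓ₀ N) (λ j → B ℕ.* T ℕ.* m j)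
        ≤⟨ ∑-≤-overlap window (λ j → B ℕ.* X ℕ.* w j) (λ j → X ℕ.* SS C j) (levels-unique ℓ₀ N) m-bound ⟩
      ∑ window (λ j → B ℕ.* X ℕ.* w j) ℕ.+ ∑ (levels ℓ₀ N) (λ j → X ℕ.* SS C j)
        ≡⟨ cong₂ ℕ._+_ (∑-* window (B ℕ.* X) w) (∑-* (levels ℓ₀ N) X (SS C)) ⟩
      B ℕ.* X ℕ.* ∑ window w ℕ.+ X ℕ.* ∑ (levels ℓ₀ N) (SS C)
        ≤⟨ ℕ.+-mono-≤ (ℕ.*-monoʳ-≤ (B ℕ.* X) ∑w≤) (ℕ.*-monoʳ-≤ X ∑SS≤B) ⟩
      B ℕ.* X ℕ.* (ε ℕ.+ suc b ℕ.+ 1) ℕ.+ X ℕ.* B                 ≡⟨ collect B X ε b ⟩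
      B ℕ.* X ℕ.* (suc ε ℕ.+ (b ℕ.+ 2))
        ≤⟨ ℕ.*-monoʳ-≤ (B ℕ.* X) (ℕ.+-mono-≤ ε<2T (ℕ.m≤n*m (b ℕ.+ 2) T {{2^≢0 τ}})) ⟩
      B ℕ.* X ℕ.* (2 ℕ.* T ℕ.+ T ℕ.* (b ℕ.+ 2))                   ≡⟨ factor B X T b ⟩
      B ℕ.* T ℕ.* (X ℕ.* (b ℕ.+ 4))                               ∎)
      where
      collect : ∀ B X ε b → B ℕ.* X ℕ.* (ε ℕ.+ (1 ℕ.+ b) ℕ.+ 1) ℕ.+ X ℕ.* B ≡ B ℕ.* X ℕ.* (1 ℕ.+ ε ℕ.+ (b ℕ.+ 2))
      collect = ℕSolver.solve-∀
      factor : ∀ B X T b → B ℕ.* X ℕ.* (2 ℕ.* T ℕ.+ T ℕ.* (b ℕ.+ 2)) ≡ B ℕ.* T ℕ.* (X ℕ.* (b ℕ.+ 4))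
      factor = ℕSolver.solve-∀

    total-< : N ℕ.≤ X → (b ℕ.+ 10) ℕ.* X ℕ.< 2 ^ b → total C G↑ ℕ.< 2 ^ b
    total-< N≤X [b+10]X<2^b = begin-strict
      total C G↑
        ≤⟨ ∑-mono (levels ℓ₀ N) (λ j → approx-≤ (SS C j) (j + G↑)) ⟩
      ∑ (levels ℓ₀ N) (λ j → 1 ℕ.+ m j)                 ≡⟨ ∑-+ (levels ℓ₀ N) (λ _ → 1) m ⟩
      ∑ (levels ℓ₀ N) (λ _ → 1) ℕ.+ ∑ (levels ℓ₀ N) m
        ≡⟨ cong (ℕ._+ ∑ (levels ℓ₀ N) m) (trans (∑-levels-const ℓ₀ N 1) (ℕ.*-identityʳ N)) ⟩
      N ℕ.+ ∑ (levels ℓ₀ N) m                           ≤⟨ ℕ.+-mono-≤ N≤X ∑m≤ ⟩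
      X ℕ.+ X ℕ.* (b ℕ.+ 4)                             ≡⟨ collect X b ⟩
      (b ℕ.+ 5) ℕ.* X
        ≤⟨ ℕ.*-monoˡ-≤ X (ℕ.+-monoʳ-≤ b (s≤s (s≤s (s≤s (s≤s (s≤s z≤n)))))) ⟩
      (b ℕ.+ 10) ℕ.* X                                  <⟨ [b+10]X<2^b ⟩
      2 ^ b                                             ∎
      where
      collect : ∀ x b → x ℕ.+ x ℕ.* (b ℕ.+ 4) ≡ (b ℕ.+ 5) ℕ.* x
      collect = ℕSolver.solve-∀

-- Translating the integer and logarithmic hypotheses, and combining the four claims

mainTheorem10 : ∀ (b N K Δ R L₀ L : ℕ) (ℓ₀ : ℤ) →
    2 ℕ.≤ b →
    1 ℕ.≤ N → 1 ℕ.≤ K → 1 ℕ.≤ Δ → 1 ℕ.≤ R → 1 ℕ.≤ L₀ → 1 ℕ.≤ L →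
    + 2 ≤ + Δ → + Δ ≤ + R - + K → + R - + K < + b - + K - + 2 →
    log₂ N < (+ K) → K ℕ.≤ L₀ → L₀ ℕ.≤ L → log₂ (b ℕ.+ 10) < (+ b - + L) →
    (∀ (C : Configuration b ℓ₀ N) (top : ℤ) → IsSingleton C top →
    let G = + L₀ + 1ℤ - + b - top in
    + (2 ^ K) ≤ A C G × A C G < + (2 ^ b))
    ×
    (∀ (C C′ : Configuration b ℓ₀ N) (ℓ : ℤ) → AddedAt ℓ C C′ →
    ∀ (G : ℤ) → A C G < + (2 ^ b) →
    (Aₗ C′ ℓ G ≥ + (2 ^ b) →
    let G↓ = + R - + ⌊log₂ SS C′ ℓ ⌋ - ℓ in
    + (2 ^ K) ≤ A C′ G↓ × A C′ G↓ < + (2 ^ b))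
    ×
    (Aₗ C′ ℓ G < + (2 ^ b) → A C′ G ≥ + (2 ^ b) →
    let G↓ = G - + Δ in
    + (2 ^ K) ≤ A C′ G↓ × A C′ G↓ < + (2 ^ b)))
    ×
    (∀ (C C′ : Configuration b ℓ₀ N) → RemovedFrom C C′ →
    ∀ (G : ℤ) →
    A C′ G ≤ A C G × (A C G < + (2 ^ b) → A C′ G < + (2 ^ b)))
    ×
    (∀ (C : Configuration b ℓ₀ N) → Nonempty C →
    ∀ (top : ℤ) → LargestNonempty C top →
    let G↑ = + L + 1ℤ - + b - + t C top - top in
    + (2 ^ L) ≤ A C G↑ × A C G↑ < + (2 ^ b))
mainTheorem10 b N K Δ R L₀ L ℓ₀ 2≤b _ _ _ _ _ _ 2≤Δ Δ≤R-K R-K<b-K-2 log₂N<K K≤L₀ L₀≤L log₂[b+10]<b-L =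
  singleton , added , removed , raised
  where
  K+Δ≤R : K ℕ.+ Δ ℕ.≤ R
  K+Δ≤R = ℤ.drop‿+≤+ (subst (+ (K ℕ.+ Δ) ≤_) (cancel (+ K) (+ R)) (ℤ.+-monoʳ-≤ (+ K) Δ≤R-K))
    where
    cancel : ∀ k r → k + (r - k) ≡ r
    cancel = ℤSolver.solve-∀

  -- K cancels, and strictness over the integers turns R + 2 < b into this form.
  R+3≤b : R ℕ.+ 3 ℕ.≤ b
  R+3≤b = subst (ℕ._≤ b) (sym (ℕ.+-suc R 2))
    (ℤ.drop‿+<+ (subst₂ _<_ (lhs (+ K) (+ R)) (rhs (+ K) (+ b)) (ℤ.+-monoʳ-< (+ K + + 2) R-K<b-K-2)))
    where
    lhs : ∀ k r → (k + + 2) + (r - k) ≡ r + + 2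
    lhs = ℤSolver.solve-∀
    rhs : ∀ k b → (k + + 2) + (b - k - + 2) ≡ b
    rhs = ℤSolver.solve-∀

  N<2^K : N ℕ.< 2 ^ K
  N<2^K = subst (ℕ._< 2 ^ K) (ℕ.*-identityʳ N) (log₂<⇒ {N} {+ K} {K} {0} (sym (ℤ.+-identityʳ (+ K))) log₂N<K)

  [b+10]2^L<2^b : (b ℕ.+ 10) ℕ.* 2 ^ L ℕ.< 2 ^ b
  [b+10]2^L<2^b = log₂<⇒ {b ℕ.+ 10} {+ b - + L} {b} {L} refl log₂[b+10]<b-L

  -- The factor b + 10 is worth at least one doubling: 2 * 2^L₀ ≤ (b + 10) 2^L < 2^b.
  1+L₀<b : suc L₀ ℕ.< b
  1+L₀<b = 2^-cancel-< (ℕ.≤-<-trans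
    (ℕ.*-mono-≤ (ℕ.≤-trans 2≤b (ℕ.m≤m+n b 10)) (ℕ.^-monoʳ-≤ 2 L₀≤L)) [b+10]2^L<2^b)

  total<2^b : ∀ (C : Configuration b ℓ₀ N) G → A C G < + (2 ^ b) → total C G ℕ.< 2 ^ b
  total<2^b C G lt = ℤ.drop‿+<+ (subst (_< + (2 ^ b)) (A≡total C G) lt)

  singleton : ∀ (C : Configuration b ℓ₀ N) top → IsSingleton C top → _
  singleton C top single
    with singleton-bounds (ℕ.≤-trans (s≤s z≤n) 2≤b) K≤L₀ 1+L₀<b C top single
  ... | lower , upper = A-bounds C _ lower upper

  added : ∀ (C C′ : Configuration b ℓ₀ N) ℓ → AddedAt ℓ C C′ → ∀ G → A C G < + (2 ^ b) → _ × _
  added C C′ ℓ add G A<2^b = large , small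
    where
    open Added {C = C} {C′} {ℓ} add
    2≤Δ′ = ℤ.drop‿+≤+ 2≤Δ
    large : Aₗ C′ ℓ G ≥ + (2 ^ b) → _
    large ≥2^b = A-bounds C′ _
      (large-shift-≥ N<2^K 2≤Δ′ K+Δ≤R R+3≤b G (total<2^b C G A<2^b) 2^b≤term)
      (large-shift-< N<2^K 2≤Δ′ K+Δ≤R R+3≤b G (total<2^b C G A<2^b) 2^b≤term)
      where
      2^b≤term : 2 ^ b ℕ.≤ term C′ G ℓ
      2^b≤term = ℤ.drop‿+≤+ (subst (+ (2 ^ b) ≤_) (Aₗ≡term C′ ℓ G) ≥2^b)
    small : Aₗ C′ ℓ G < + (2 ^ b) → A C′ G ≥ + (2 ^ b) → _
    small Aₗ<2^b ≥2^b with small-shift N<2^K 2≤Δ′ K+Δ≤R R+3≤b G (total<2^b C G A<2^b)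
      (ℤ.drop‿+<+ (subst (_< + (2 ^ b)) (Aₗ≡term C′ ℓ G) Aₗ<2^b))
      (ℤ.drop‿+≤+ (subst (+ (2 ^ b) ≤_) (A≡total C′ G) ≥2^b))
    ... | lower , upper = A-bounds C′ _ lower upper

  removed : ∀ (C C′ : Configuration b ℓ₀ N) → RemovedFrom C C′ → ∀ G →
    A C′ G ≤ A C G × (A C G < + (2 ^ b) → A C′ G < + (2 ^ b))
  removed C C′ rem G = A′≤A , ℤ.≤-<-trans A′≤A
    where
    A′≤A : A C′ G ≤ A C G
    A′≤A = subst₂ _≤_ (sym (A≡total C′ G)) (sym (A≡total C G)) (ℤ.+≤+ (removal-mono C C′ rem G))

  raised : ∀ (C : Configuration b ℓ₀ N) → Nonempty C → ∀ top → LargestNonempty C top → _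
  raised C _ top largest = A-bounds C _ total-≥
    (total-< (ℕ.≤-trans (ℕ.<⇒≤ N<2^K) (ℕ.^-monoʳ-≤ 2 (ℕ.≤-trans K≤L₀ L₀≤L))) [b+10]2^L<2^b)
    where
    open Raise C top
    open Shift largest L 2≤b (t C top) 2^t≤ε⊔1 ε<2*2^t
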